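{- For every $k\ge2$, the following problem is undecidable: given a finite $k$-dimensional weighted game $G=(S_0,S_1,E)$, an initial state $s_{\mathrm{init}}\in S$, and a threshold $t\in\mathbb Q^k$, determine whether $P_0$ has a winning strategy from $s_{\mathrm{init}}$ for the objective $\mathrm{AEL}(t)=\{\pi\mid\forall n\ge1:\ \mathrm{EL}(\pi_{\le n})\ge 0\}\cap\{\pi\mid\overline{\mathrm{AE}}(\pi)\le t\}$.
   Context: A $k$-dimensional weighted game is $G=(S_0,S_1,E)$ with $S_0,S_1$ finite disjoint sets of states of players $P_0,P_1$, $S=S_0\cup S_1$, and $E\subseteq S\times[-W,W]^k\times S$ a finite set of edges weighted by integer vectors; every state has an outgoing edge. Plays (infinite edge sequences $e_1e_2\cdots$ with $\mathrm{tgt}(e_i)=\mathrm{src}(e_{i+1})$) and prefixes are as usual; $\pi_{\le n}$ is the prefix of the first $n$ edges. For a nonempty prefix $\rho=e_1\cdots e_n$, $\mathrm{EL}(\rho)=\sum_{i=1}^n w(e_i)\in\mathbb Z^k$ (initial energy zero) and $\mathrm{AE}(\rho)=\frac1n\sum_{i=1}^n\mathrm{EL}(e_1\cdots e_i)$; for a play $\pi$, $\overline{\mathrm{AE}}(\pi)$ is the componentwise $\limsup$ of $\mathrm{AE}(\pi_{\le n})$. All vector inequalities are componentwise. A strategy of $P_i$ maps every prefix ending in $S_i$ to an outgoing edge of its last state; a strategy of $P_0$ is winning if all its outcomes belong to the objective. -}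

module Defs where

open import Data.Nat as ℕ using (ℕ; zero; suc; _≤_)
open import Data.Integer as ℤ using (ℤ; +_; -[1+_])
open import Data.Rational as ℚ using (ℚ)
open import Data.Fin using (Fin; toℕ)
open import Data.Vec using (Vec; lookup; toList)
open import Data.List using (List; []; _∷_; map; upTo; length; lookup)
open import Data.List.Membership.Propositional using (_∈_)
open import Data.Bool using (Bool; true; false)
open import Data.Maybe using (Maybe; just; nothing)
open import Data.Product using (Σ; _×_; _,_; proj₁; proj₂; ∃)
open import Relation.Binary.PropositionalEquality using (_≡_)
open import Relation.Nullary using (¬_; yes; no)

Edge : ℕ → ℕ → Set
Edge n k = Fin n × Vec ℤ k × Fin n

src : ∀ {n k} → Edge n k → Fin n
src (s , _ , _) = s

wt : ∀ {n k} → Edge n k → Vec ℤ k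
wt (_ , w , _) = w

tgt : ∀ {n k} → Edge n k → Fin n
tgt (_ , _ , t) = t

-- A problem instance: a finite k-dimensional weighted game (states Fin n,
-- owner s = true iff s ∈ S₀), an initial state and a threshold t ∈ ℚ^k.
record Instance (k : ℕ) : Set where
  field
    n      : ℕ
    owner  : Vec Bool n
    edges  : List (Edge n k)
    init   : Fin n
    thr    : Vec ℚ k

WellFormed : ∀ {k} → Instance k → Set
WellFormed I = ∀ (s : Fin n) → Σ (Edge n _) λ e → e ∈ edges × src e ≡ s
  where open Instance I

module _ {k : ℕ} (I : Instance k) where
  open Instance I

  cur : Fin n → List (Edge n k) → Fin n
  cur s []       = s
  cur s (e ∷ es) = cur (tgt e) es

  data IsPath : Fin n → List (Edge n k) → Set where
    []ᵖ  : ∀ {s} → IsPath s []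
    _∷ᵖ_ : ∀ {s e es} → (e ∈ edges × src e ≡ s) → IsPath (tgt e) es → IsPath s (e ∷ es)

  Strategy : Set
  Strategy = List (Edge n k) → Edge n k

  ValidStrategy : Strategy → Set
  ValidStrategy σ = ∀ h → IsPath init h → Data.Vec.lookup owner (cur init h) ≡ true →
                    σ h ∈ edges × src (σ h) ≡ cur init h

  Play : Set
  Play = ℕ → Edge n k

  IsPlay : Play → Set
  IsPlay π = src (π 0) ≡ init × (∀ i → π i ∈ edges × tgt (π i) ≡ src (π (suc i)))

  prefix : Play → ℕ → List (Edge n k)
  prefix π i = map π (upTo i)

  Consistent : Strategy → Play → Set
  Consistent σ π = ∀ i → Data.Vec.lookup owner (src (π i)) ≡ true → π i ≡ σ (prefix π i)

  energy : Play → Fin k → ℕ → ℤ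
  energy π j zero    = + 0
  energy π j (suc i) = energy π j i ℤ.+ Data.Vec.lookup (wt (π i)) j

  sumEnergy : Play → Fin k → ℕ → ℤ
  sumEnergy π j zero    = + 0
  sumEnergy π j (suc m) = sumEnergy π j m ℤ.+ energy π j (suc m)

  -- j-th component of AE(π_{≤ suc m})
  AE : Play → Fin k → ℕ → ℚ
  AE π j m = sumEnergy π j (suc m) ℚ./ suc m

  EnergyOK : Play → Set
  EnergyOK π = ∀ i → 1 ≤ i → ∀ j → + 0 ℤ.≤ energy π j i

  -- limsup_n AE_j(π_{≤ n}) ≤ t_j for all j, i.e. for every rational ε > 0,
  -- eventually AE_j ≤ t_j + ε.
  LimsupAEOK : Play → Set
  LimsupAEOK π = ∀ j → ∀ (ε : ℚ) → ℚ.Positive ε →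
    ∃ λ N → ∀ m → N ≤ m → AE π j m ℚ.≤ (Data.Vec.lookup thr j ℚ.+ ε)

  InAEL : Play → Set
  InAEL π = EnergyOK π × LimsupAEOK π

  Winning : Set
  Winning = Σ Strategy λ σ → ValidStrategy σ ×
            (∀ π → IsPlay π → Consistent σ π → InAEL π)

-- Model of computation: (Minsky) register machines with unboundedly many
-- registers.  Input in register 0, output read from register 0 on halting.

data Instr : Set where
  inc : (r l : ℕ) → Instr
  dec : (r l₁ l₂ : ℕ) → Instr      -- if r = 0 goto l₂ else r := r-1; goto l₁

Program : Set
Program = List Instr

record Config : Set where
  constructor ⟨_,_⟩
  field
    pc   : ℕ
    regs : ℕ → ℕ

update : (ℕ → ℕ) → ℕ → ℕ → (ℕ → ℕ)
update f r v x with x ℕ.≟ r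
... | yes _ = v
... | no  _ = f x

-- next instruction, or nothing if pc is out of range (halted)
fetch : Program → ℕ → Maybe Instr
fetch []       _       = nothing
fetch (i ∷ _)  zero    = just i
fetch (_ ∷ is) (suc p) = fetch is p

exec : Program → ℕ → Config → Maybe Config
exec P f ⟨ p , ρ ⟩ with fetch P p
exec P f       ⟨ p , ρ ⟩ | nothing = just ⟨ p , ρ ⟩
exec P zero    ⟨ p , ρ ⟩ | just _  = nothing
exec P (suc f) ⟨ p , ρ ⟩ | just (inc r l) = exec P f ⟨ l , update ρ r (suc (ρ r)) ⟩
exec P (suc f) ⟨ p , ρ ⟩ | just (dec r l₁ l₂) with ρ r
... | zero  = exec P f ⟨ l₂ , ρ ⟩
... | suc v = exec P f ⟨ l₁ , update ρ r v ⟩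

initRegs : ℕ → ℕ → ℕ
initRegs x zero    = x
initRegs x (suc _) = 0

run : Program → ℕ → ℕ → Maybe ℕ
run P x f with exec P f ⟨ 0 , initRegs x ⟩
... | nothing = nothing
... | just ⟨ _ , ρ ⟩ = just (ρ 0)

Decides : Program → ℕ → Set → Set
Decides P x A = Σ ℕ λ f → Σ ℕ λ b → run P x f ≡ just b × (A → b ≡ 1) × (b ≡ 1 → A)

tri : ℕ → ℕ
tri zero    = 0
tri (suc m) = suc m ℕ.+ tri m

pair : ℕ → ℕ → ℕ
pair a b = tri (a ℕ.+ b) ℕ.+ b

encList : List ℕ → ℕ
encList []       = 0
encList (x ∷ xs) = suc (pair x (encList xs))

encℤ : ℤ → ℕ
encℤ (+ m)      = 2 ℕ.* m
encℤ -[1+ m ]   = suc (2 ℕ.* m)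

encℚ : ℚ → ℕ
encℚ q = pair (encℤ (ℚ.ℚ.numerator q)) (ℚ.ℚ.denominator-1 q)

encBool : Bool → ℕ
encBool false = 0
encBool true  = 1

encEdge : ∀ {n k} → Edge n k → ℕ
encEdge (s , w , t) = encList (toℕ s ∷ encList (toList (Data.Vec.map encℤ w)) ∷ toℕ t ∷ [])

encode : ∀ {k} → Instance k → ℕ
encode I = encList
  ( n
  ∷ encList (toList (Data.Vec.map encBool owner))
  ∷ encList (map encEdge edges)
  ∷ toℕ init
  ∷ encList (toList (Data.Vec.map encℚ thr))
  ∷ [])
  where open Instance I

{-# OPTIONS --safe #-}
module Submission where

-- A register machine is turned into a game with two energies and threshold 0.
-- The registers are stored as the Gödel number v = ∏ pᵢ^xᵢ for pairwise coprime
-- pᵢ: one energy is v, the other is 0.  To multiply or divide v by pᵢ, P₀ loops,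
-- moving the value from one energy to the other, and then claims that the first
-- energy is 0; P₁ may challenge by stopping in a sink where that energy can no
-- longer decrease, so that a wrong claim makes its average positive.  A claim
-- that a register is 0 is checked by reducing v modulo pᵢ.  Since v ≥ 1, the two
-- energies sum to at least 1 throughout a faithful simulation, so P₀ wins
-- exactly if the machine halts.
--
-- The initial registers enter the game only through the weight v of the first
-- edge.  Given a decision procedure P, let M read the number of states, the code
-- of the owners and the code of the other edges from its registers, compute the
-- code of the game with these data whose first weight is the Gödel number of its
-- own registers, run P on it, and halt exactly if the answer is not 1.  Started
-- on the data of its own game, M halts iff P₀ does not win.

open import Defs
open import Data.Nat using (ℕ; zero; suc; _+_; _*_; _∸_; _^_; _⊔_; _≤_; _<_; z≤n; s≤s; _≟_)
open import Data.Nat.Properties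
open import Data.Nat.Coprimality using (Coprime; coprime-divisor)
open import Data.Nat.Divisibility
open import Data.Nat.DivMod using (_/_; _%_; m%n<n; m≡m%n+[m/n]*n)
open import Data.Nat.Tactic.RingSolver using (solve-∀)
open import Data.Integer as ℤ using (ℤ; +_; -[1+_])
import Data.Integer.Properties as ℤ
open import Data.Rational as ℚ using (ℚ; 0ℚ)
import Data.Rational.Properties as ℚ
open import Data.Rational.Unnormalised as ℚᵘ using (mkℚᵘ)
import Data.Rational.Unnormalised.Properties as ℚᵘ
open import Algebra.Properties.CommutativeSemigroup ℤ.+-commutativeSemigroup using (interchange)
open import Data.Bool using (Bool; true; false; not)
open import Data.Bool.Properties using (not-involutive)
open import Data.Empty using (⊥)
open import Data.Fin using (Fin; zero; suc; toℕ; splitAt; join; combine; remQuot)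
open import Data.Fin.Properties using (all?; splitAt-join; remQuot-combine) renaming (_≟_ to _≟ᶠ_; suc-injective to suc-injectiveᶠ)
open import Data.Vec as Vec using (Vec; _∷_)
open import Data.Vec.Properties using (lookup-replicate; lookup∘tabulate) renaming (≡-dec to ≡-decᵛ)
open import Data.List as List using (List; []; _∷_; _∷ʳ_; length; map; upTo; applyUpTo; foldl; concatMap; allFin)
open import Data.List.Properties using (upTo-∷ʳ; map-++; foldl-∷ʳ)
open import Data.List.Membership.Propositional using (_∈_; find; lose)
open import Data.List.Membership.Propositional.Properties
import Data.List.Membership.DecPropositional as DecMembership
open import Data.List.Relation.Unary.Any using (Any; here; there)
open import Data.List.Relation.Unary.All as All using (All; []; _∷_)
open import Data.List.Relation.Unary.All.Properties using (applyUpTo⁺₁)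
open import Data.Maybe as Maybe using (Maybe; just; nothing)
open import Data.Product using (Σ; ∃; ∃₂; _×_; _,_; proj₁; proj₂)
open import Data.Product.Properties using (≡-dec)
open import Data.Sum as Sum using (_⊎_; inj₁; inj₂)
open import Function using (_∘_)
open import Relation.Binary.Definitions using (DecidableEquality)
open import Relation.Binary.PropositionalEquality
open import Relation.Nullary using (¬_; Dec; yes; no; contradiction)

-- Pairwise coprime bases and Gödel numbers

sylvesterProduct : ℕ → ℕ
sylvesterProduct zero    = 1
sylvesterProduct (suc r) = sylvesterProduct r * suc (sylvesterProduct r)

-- The sequence 2, 3, 7, 43, ..., in which each term is one more than the product of all earlier
-- terms. Coprimality of the bases is thus built into the recursion.
sylvester : ℕ → ℕ
sylvester r = suc (sylvesterProduct r)

sylvesterProduct≥1 : ∀ r → 1 ≤ sylvesterProduct r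
sylvesterProduct≥1 zero    = s≤s z≤n
sylvesterProduct≥1 (suc r) = *-mono-≤ (sylvesterProduct≥1 r) (s≤s (z≤n {sylvesterProduct r}))

sylvester∣product : ∀ i d → sylvester i ∣ sylvesterProduct (suc d + i)
sylvester∣product i zero    = n∣m*n (sylvesterProduct i)
sylvester∣product i (suc d) = ∣m⇒∣m*n _ (sylvester∣product i d)

-- The later term is one more than a multiple of the earlier one, so a common divisor divides 1.
sylvester-coprime : ∀ i d → Coprime (sylvester i) (sylvester (suc d + i))
sylvester-coprime i d {k} (k∣i , k∣d+i) =
  ∣1⇒≡1 (∣m+n∣m⇒∣n (subst (k ∣_) (+-comm 1 (sylvesterProduct (suc d + i))) k∣d+i)
                   (∣-trans k∣i (sylvester∣product i d)))

sylvester∤1 : ∀ r → ¬ (sylvester r ∣ 1)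
sylvester∤1 r d = <-irrefl (sym (∣1⇒≡1 d)) (s≤s (sylvesterProduct≥1 r))

coprime-divisor-^ : ∀ {m n o} x → Coprime m n → m ∣ n ^ x * o → m ∣ o
coprime-divisor-^ {o = o} zero c d = subst (_ ∣_) (*-identityˡ o) d
coprime-divisor-^ {m} {n} {o} (suc x) c d =
  coprime-divisor-^ x c (coprime-divisor c (subst (m ∣_) (*-assoc n (n ^ x) o) d))

-- Registers beyond the end of the list hold 0. The finite support makes the Gödel number a finite
-- product.
Registers : Set
Registers = List ℕ

value : Registers → ℕ → ℕ
value []       _       = 0
value (x ∷ xs) zero    = x
value (x ∷ xs) (suc r) = value xs r

increment : ℕ → Registers → Registers
increment zero    []       = 1 ∷ []
increment zero    (x ∷ xs) = suc x ∷ xs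
increment (suc r) []       = 0 ∷ increment r []
increment (suc r) (x ∷ xs) = x ∷ increment r xs

decrement : ℕ → Registers → Maybe Registers
decrement zero    []           = nothing
decrement zero    (zero ∷ xs)  = nothing
decrement zero    (suc x ∷ xs) = just (x ∷ xs)
decrement (suc r) []           = nothing
decrement (suc r) (x ∷ xs)     = Maybe.map (x ∷_) (decrement r xs)

goedelFrom : ℕ → Registers → ℕ
goedelFrom i []       = 1
goedelFrom i (x ∷ xs) = sylvester i ^ x * goedelFrom (suc i) xs

goedel : Registers → ℕ
goedel = goedelFrom 0

goedelFrom≥1 : ∀ i xs → 1 ≤ goedelFrom i xs
goedelFrom≥1 i []       = s≤s z≤n
goedelFrom≥1 i (x ∷ xs) = *-mono-≤ (m^n>0 (sylvester i) x) (goedelFrom≥1 (suc i) xs)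

private
  swap-factor : ∀ a b c → a * (b * c) ≡ b * (a * c)
  swap-factor = solve-∀

goedelFrom-increment : ∀ r i xs →
  goedelFrom i (increment r xs) ≡ sylvester (r + i) * goedelFrom i xs
goedelFrom-increment zero    i []       = *-assoc (sylvester i) 1 1
goedelFrom-increment zero    i (x ∷ xs) = *-assoc (sylvester i) (sylvester i ^ x) _
goedelFrom-increment (suc r) i []       =
  trans (*-identityˡ _) (trans (goedelFrom-increment r (suc i) []) (cong (λ n → sylvester n * 1) (+-suc r i)))
goedelFrom-increment (suc r) i (x ∷ xs) =
  trans (cong (sylvester i ^ x *_) (goedelFrom-increment r (suc i) xs))
  (trans (swap-factor (sylvester i ^ x) (sylvester (r + suc i)) (goedelFrom (suc i) xs))
         (cong (λ n → sylvester n * (sylvester i ^ x * goedelFrom (suc i) xs)) (+-suc r i)))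

goedelFrom-decrement : ∀ r i xs {ys} → decrement r xs ≡ just ys →
  goedelFrom i xs ≡ sylvester (r + i) * goedelFrom i ys
goedelFrom-decrement zero    i (suc x ∷ xs) refl = *-assoc (sylvester i) (sylvester i ^ x) _
goedelFrom-decrement (suc r) i (x ∷ xs) eq with decrement r xs in eq′ | eq
... | just ys | refl =
  trans (cong (sylvester i ^ x *_) (goedelFrom-decrement r (suc i) xs eq′))
  (trans (swap-factor (sylvester i ^ x) (sylvester (r + suc i)) (goedelFrom (suc i) ys))
         (cong (λ n → sylvester n * (sylvester i ^ x * goedelFrom (suc i) ys)) (+-suc r i)))

-- Only bases of larger index occur in the product. Coprimality cancels their powers until 1 is
-- left.
sylvester∤later : ∀ i d xs → ¬ (sylvester i ∣ goedelFrom (suc d + i) xs)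
sylvester∤later i d []       = sylvester∤1 i
sylvester∤later i d (x ∷ xs) p =
  sylvester∤later i (suc d) xs (coprime-divisor-^ x (sylvester-coprime i d) p)

-- An empty register contributes the factor 1, and all other bases are coprime to its own: the
-- recursion strips those of smaller index, `sylvester∤later` those of larger index.
sylvester∤goedelFrom : ∀ r i xs → decrement r xs ≡ nothing → ¬ (sylvester (r + i) ∣ goedelFrom i xs)
sylvester∤goedelFrom r       i []          eq p = sylvester∤1 (r + i) p
sylvester∤goedelFrom zero    i (zero ∷ xs) eq p = sylvester∤later i 0 xs (subst (_ ∣_) (*-identityˡ _) p)
sylvester∤goedelFrom (suc r) i (x ∷ xs)    eq p with decrement r xs in eq′
... | nothing = sylvester∤goedelFrom r (suc i) xs eq′
  (subst (λ n → sylvester n ∣ goedelFrom (suc i) xs) (sym (+-suc r i))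
    (coprime-divisor-^ x later-coprime p))
  where
  later-coprime : Coprime (sylvester (suc r + i)) (sylvester i)
  later-coprime (k∣ , k∣i) = sylvester-coprime i r (k∣i , k∣)

goedel-increment : ∀ r xs → goedel (increment r xs) ≡ sylvester r * goedel xs
goedel-increment r xs = subst (λ n → goedel (increment r xs) ≡ sylvester n * goedel xs)
  (+-identityʳ r) (goedelFrom-increment r 0 xs)

goedel-decrement : ∀ r xs {ys} → decrement r xs ≡ just ys → goedel xs ≡ sylvester r * goedel ys
goedel-decrement r xs {ys} eq = subst (λ n → goedel xs ≡ sylvester n * goedel ys)
  (+-identityʳ r) (goedelFrom-decrement r 0 xs eq)

sylvester∤goedel : ∀ r xs → decrement r xs ≡ nothing → ¬ (sylvester r ∣ goedel xs)
sylvester∤goedel r xs eq = subst (λ n → ¬ (sylvester n ∣ goedel xs))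
  (+-identityʳ r) (sylvester∤goedelFrom r 0 xs eq)

-- Register machines

-- Abstract in the labels: programs jump to numbers, compiled machines to `Maybe Q`, where `nothing`
-- is the halting label.
data Operation (X : Set) : Set where
  inc : (r : ℕ) (l : X) → Operation X
  dec : (r : ℕ) (l₁ l₂ : X) → Operation X

perform : ∀ {X} → Operation X → Registers → X × Registers
perform (inc r l) xs = l , increment r xs
perform (dec r l₁ l₂) xs with decrement r xs
... | just ys = l₁ , ys
... | nothing = l₂ , xs

perform-zero : ∀ {X : Set} r {l₁ l₂ : X} xs → decrement r xs ≡ nothing → perform (dec r l₁ l₂) xs ≡ (l₂ , xs)
perform-zero r xs eq rewrite eq = refl

perform-suc : ∀ {X : Set} r {l₁ l₂ : X} xs {ys} → decrement r xs ≡ just ys → perform (dec r l₁ l₂) xs ≡ (l₁ , ys)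
perform-suc r xs eq rewrite eq = refl

mapOperation : ∀ {X Y : Set} → (X → Y) → Operation X → Operation Y
mapOperation f (inc r l)     = inc r (f l)
mapOperation f (dec r l₁ l₂) = dec r (f l₁) (f l₂)

perform-map : ∀ {X Y : Set} (f : X → Y) o xs {x ys} → perform o xs ≡ (x , ys) →
              perform (mapOperation f o) xs ≡ (f x , ys)
perform-map f (inc r l) xs refl = refl
perform-map f (dec r l₁ l₂) xs eq with decrement r xs | eq
... | just ys | refl = refl
... | nothing | refl = refl

operation : Instr → Operation ℕ
operation (inc r l)     = inc r l
operation (dec r l₁ l₂) = dec r l₁ l₂

target : (P : Program) → ℕ → Maybe (Fin (length P))
target []      _       = nothing
target (_ ∷ P) zero    = just zero
target (_ ∷ P) (suc l) = Maybe.map suc (target P l)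

fetch-target : ∀ P l → fetch P l ≡ Maybe.map (List.lookup P) (target P l)
fetch-target []      l       = refl
fetch-target (_ ∷ P) zero    = refl
fetch-target (_ ∷ P) (suc l) with target P l | fetch-target P l
... | just _  | eq = eq
... | nothing | eq = eq

-- Structured commands and their compilation

data Command : Set where
  inc   : (r : ℕ) → Command
  _；_  : (c d : Command) → Command
  while : (r : ℕ) (c : Command) → Command
  raw   : (P : Program) → Command

infixr 5 _；_

Position : Command → Set
Position (inc r)     = Fin 1
Position (c ； d)    = Position c ⊎ Position d
Position (while r c) = Fin 1 ⊎ Position c
Position (raw P)     = Fin (length P)

-- A jump out of the range of `P` halts `P`; inside a larger machine it becomes a jump to the exit
-- `k`.
locate : ∀ {X : Set} (P : Program) → X → (Fin (length P) → X) → ℕ → X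
locate P k i l = Maybe.maybe′ i k (target P l)

-- Code is parametrised by the label k reached on exit and by the embedding i
-- of the positions into the labels.

entry : ∀ {X : Set} (c : Command) → X → (Position c → X) → X
entry (inc r)     k i = i zero
entry (c ； d)    k i = entry c (entry d k (i ∘ inj₂)) (i ∘ inj₁)
entry (while r c) k i = i (inj₁ zero)
entry (raw P)     k i = locate P k i 0

code : ∀ {X : Set} (c : Command) → X → (Position c → X) → Position c → Operation X
code (inc r)     k i _        = inc r k
code (c ； d)    k i (inj₁ p) = code c (entry d k (i ∘ inj₂)) (i ∘ inj₁) p
code (c ； d)    k i (inj₂ p) = code d k (i ∘ inj₂) p
code (while r c) k i (inj₁ _) = dec r (entry c (i (inj₁ zero)) (i ∘ inj₂)) k
code (while r c) k i (inj₂ p) = code c (i (inj₁ zero)) (i ∘ inj₂) p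
code (raw P)     k i p        = mapOperation (locate P k i) (operation (List.lookup P p))

data Run (P : Program) : ℕ → Registers → Registers → Set where
  halt : ∀ {l xs} → target P l ≡ nothing → Run P l xs xs
  step : ∀ {l xs p l′ ys zs} → target P l ≡ just p →
         perform (operation (List.lookup P p)) xs ≡ (l′ , ys) → Run P l′ ys zs → Run P l xs zs

data _⊢_⇒_ : Command → Registers → Registers → Set where
  inc       : ∀ {r xs} → inc r ⊢ xs ⇒ increment r xs
  _；_      : ∀ {c d xs ys zs} → c ⊢ xs ⇒ ys → d ⊢ ys ⇒ zs → (c ； d) ⊢ xs ⇒ zs
  while-end : ∀ {r c xs} → decrement r xs ≡ nothing → while r c ⊢ xs ⇒ xs
  while-go  : ∀ {r c xs ys zs us} → decrement r xs ≡ just ys → c ⊢ ys ⇒ zs →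
              while r c ⊢ zs ⇒ us → while r c ⊢ xs ⇒ us
  raw       : ∀ {P xs ys} → Run P 0 xs ys → raw P ⊢ xs ⇒ ys

module Machine (Q : Set) (instr : Q → Operation (Maybe Q)) where

  data Halts : Maybe Q × Registers → Set where
    stop : ∀ {xs} → Halts (nothing , xs)
    step : ∀ {q xs} → Halts (perform (instr q) xs) → Halts (just q , xs)

  -- Both directions are used in the diagonal argument: one carries divergence of the final phase
  -- back to the start, the other carries halting back.
  _≈_ : Maybe Q × Registers → Maybe Q × Registers → Set
  x ≈ y = (Halts x → Halts y) × (Halts y → Halts x)

  ≈-trans : ∀ {x y z} → x ≈ y → y ≈ z → x ≈ z
  ≈-trans (f , g) (f′ , g′) = f′ ∘ f , g ∘ g′

  ≈-step : ∀ {q xs y} → perform (instr q) xs ≡ y → (just q , xs) ≈ y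
  ≈-step refl = (λ { (step h) → h }) , step

  -- Correctness is stated for code embedded in a larger machine, so that the parts of a sequence
  -- and the body of a loop are handled by restricting the embedding `i`.
  Placed : (c : Command) → Maybe Q → (Position c → Q) → Set
  Placed c k i = ∀ p → instr (i p) ≡ code c k (just ∘ i) p

  simulate-raw : ∀ P {k i l xs ys} → Placed (raw P) k i → Run P l xs ys →
                 (locate P k (just ∘ i) l , xs) ≈ (k , ys)
  simulate-raw P {k} {i} pl (halt eq) rewrite eq = (λ h → h) , (λ h → h)
  simulate-raw P {k} {i} pl (step {xs = xs} {p = p} eq pf r) rewrite eq =
    ≈-trans (≈-step (trans (cong (λ o → perform o xs) (pl p))
                           (perform-map (locate P k (just ∘ i)) (operation (List.lookup P p)) xs pf)))
            (simulate-raw P pl r)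

  -- Induction on the terminating evaluation: a basic instruction is one machine step, and the rest
  -- of a loop is a shorter evaluation of the same placed code.
  simulate : ∀ c {k i xs ys} → Placed c k i → c ⊢ xs ⇒ ys → (entry c k (just ∘ i) , xs) ≈ (k , ys)
  simulate (inc r) {k} {xs = xs} pl inc = ≈-step {y = k , increment r xs} (cong (λ o → perform o xs) (pl zero))
  simulate (c ； d) pl (e ； f) = ≈-trans (simulate c (pl ∘ inj₁) e) (simulate d (pl ∘ inj₂) f)
  simulate (while r c) {xs = xs} pl (while-end eq) =
    ≈-step (trans (cong (λ o → perform o xs) (pl (inj₁ zero))) (perform-zero r xs eq))
  simulate (while r c) {xs = xs} pl (while-go eq e f) =
    ≈-trans (≈-step (trans (cong (λ o → perform o xs) (pl (inj₁ zero))) (perform-suc r xs eq)))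
    (≈-trans (simulate c (pl ∘ inj₂) e) (simulate (while r c) pl f))
  simulate (raw P) pl (raw r) = simulate-raw P pl r

-- From fuelled execution on functions to runs on lists

_Represents_ : Registers → (ℕ → ℕ) → Set
xs Represents ρ = ∀ r → value xs r ≡ ρ r

increment-represents : ∀ r {xs ρ v} → xs Represents ρ → v ≡ suc (ρ r) → increment r xs Represents update ρ r v
increment-represents r {xs} {ρ} rep refl x with x ≟ r
... | yes refl = trans (at x xs) (cong suc (rep x))
  where
  at : ∀ r xs → value (increment r xs) r ≡ suc (value xs r)
  at zero    []       = refl
  at zero    (x ∷ xs) = refl
  at (suc r) []       = at r []
  at (suc r) (x ∷ xs) = at r xs
... | no x≢r = trans (off x r xs x≢r) (rep x)
  where
  off : ∀ x r xs → x ≢ r → value (increment r xs) x ≡ value xs x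
  off zero    zero    xs       x≢r = contradiction refl x≢r
  off (suc x) zero    []       x≢r = refl
  off (suc x) zero    (y ∷ xs) x≢r = refl
  off zero    (suc r) []       x≢r = refl
  off zero    (suc r) (y ∷ xs) x≢r = refl
  off (suc x) (suc r) []       x≢r = off x r [] (x≢r ∘ cong suc)
  off (suc x) (suc r) (y ∷ xs) x≢r = off x r xs (x≢r ∘ cong suc)

decrement-nothing : ∀ r xs → value xs r ≡ 0 → decrement r xs ≡ nothing
decrement-nothing zero    []          eq = refl
decrement-nothing zero    (zero ∷ xs) eq = refl
decrement-nothing (suc r) []          eq = refl
decrement-nothing (suc r) (x ∷ xs)    eq rewrite decrement-nothing r xs eq = refl

decrement-just : ∀ r xs {v} → value xs r ≡ suc v → ∃ λ ys → decrement r xs ≡ just ys ×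
                 value ys r ≡ v × (∀ x → x ≢ r → value ys x ≡ value xs x)
decrement-just zero    (suc x ∷ xs) refl = x ∷ xs , refl , refl , off
  where
  off : ∀ y → y ≢ 0 → value (x ∷ xs) y ≡ value (suc x ∷ xs) y
  off zero    y≢0 = contradiction refl y≢0
  off (suc y) y≢0 = refl
decrement-just (suc r) (x ∷ xs) eq with decrement-just r xs eq
... | ys , eq′ , at , off rewrite eq′ = x ∷ ys , refl , at , off′
  where
  off′ : ∀ y → y ≢ suc r → value (x ∷ ys) y ≡ value (x ∷ xs) y
  off′ zero    y≢r = refl
  off′ (suc y) y≢r = off y (y≢r ∘ cong suc)

decrement-represents : ∀ r {xs ρ v} → xs Represents ρ → ρ r ≡ suc v →
                       ∃ λ ys → decrement r xs ≡ just ys × ys Represents update ρ r v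
decrement-represents r {xs} {ρ} {v} rep eq with decrement-just r xs (trans (rep r) eq)
... | ys , eq′ , at , off = ys , eq′ , rep′
  where
  rep′ : ys Represents update ρ r v
  rep′ x with x ≟ r
  ... | yes refl = at
  ... | no x≢r   = trans (off x x≢r) (rep x)

fetch-nothing : ∀ P l → fetch P l ≡ nothing → target P l ≡ nothing
fetch-nothing P l eq with target P l | fetch-target P l
... | nothing | _ = refl
... | just p  | eq′ with () ← trans (sym eq) eq′

fetch-just : ∀ P l {o} → fetch P l ≡ just o → ∃ λ p → target P l ≡ just p × List.lookup P p ≡ o
fetch-just P l eq with target P l | fetch-target P l
... | just p  | eq′ with refl ← trans (sym eq) eq′ = p , refl , refl
... | nothing | eq′ with () ← trans (sym eq) eq′

-- A successful execution unrolls, by induction on the fuel, into a finite `Run`. Pointwise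
-- representation survives every update and avoids equality of functions.
exec⇒Run : ∀ P f l ρ {l′ ρ′} xs → xs Represents ρ → exec P f ⟨ l , ρ ⟩ ≡ just ⟨ l′ , ρ′ ⟩ →
           ∃ λ ys → Run P l xs ys × ys Represents ρ′
exec⇒Run P f l ρ xs rep eq with fetch P l in fe
exec⇒Run P f l ρ xs rep refl | nothing = xs , halt (fetch-nothing P l fe) , rep
exec⇒Run P (suc f) l ρ xs rep eq | just (inc r l₁)
  with p , te , refl′ ← fetch-just P l fe
  with ys , run , rep′ ← exec⇒Run P f l₁ _ (increment r xs) (increment-represents r rep refl) eq
  = ys , step te (cong (λ o → perform (operation o) xs) refl′) run , rep′
exec⇒Run P (suc f) l ρ xs rep eq | just (dec r l₁ l₂) with ρ r in ρr
... | zero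
  with p , te , refl′ ← fetch-just P l fe
  with ys , run , rep′ ← exec⇒Run P f l₂ ρ xs rep eq
  = ys , step te (trans (cong (λ o → perform (operation o) xs) refl′)
                        (perform-zero r xs (decrement-nothing r xs (trans (rep r) ρr)))) run , rep′
... | suc v
  with p , te , refl′ ← fetch-just P l fe
  with zs , de , rep″ ← decrement-represents r {xs} rep ρr
  with ys , run , rep′ ← exec⇒Run P f l₁ _ zs rep″ eq
  = ys , step te (trans (cong (λ o → perform (operation o) xs) refl′) (perform-suc r xs de)) run , rep′

-- Attractors and traps in weighted games

toℚᵘ-/ : ∀ z m → ℚ.toℚᵘ (z ℚ./ suc m) ℚᵘ.≃ mkℚᵘ z m
toℚᵘ-/ z m = ℚ.toℚᵘ-fromℚᵘ (mkℚᵘ z m)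

-- For `ε = p/q` with `p ≥ 1`, the choice `N = c * q` works: `c * q ≤ m` implies
-- `c * q ≤ p * (m + 1)`.
/-eventually≤ : ∀ c ε → ℚ.Positive ε → ∃ λ N → ∀ m → N ≤ m → (+ c) ℚ./ suc m ℚ.≤ 0ℚ ℚ.+ ε
/-eventually≤ c ε@(ℚ.mkℚ (+ suc p) d _) _ = c * suc d , bound
  where
  bound : ∀ m → c * suc d ≤ m → (+ c) ℚ./ suc m ℚ.≤ 0ℚ ℚ.+ ε
  bound m le = subst ((+ c) ℚ./ suc m ℚ.≤_) (sym (ℚ.+-identityˡ ε))
    (ℚ.toℚᵘ-cancel-≤ (ℚᵘ.≤-respˡ-≃ (ℚᵘ.≃-sym (toℚᵘ-/ (+ c) m)) (ℚᵘ.*≤* le′)))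
    where
    le′ : + c ℤ.* + suc d ℤ.≤ + suc p ℤ.* + suc m
    le′ = subst₂ ℤ._≤_ (ℤ.pos-* c (suc d)) (ℤ.pos-* (suc p) (suc m))
      (ℤ.+≤+ (≤-trans le (≤-trans (n≤1+n m) (m≤m+n (suc m) (p * suc m)))))

/≤¼⇒*4≤ : ∀ z m → z ℚ./ suc m ℚ.≤ 0ℚ ℚ.+ (+ 1) ℚ./ 4 → z ℤ.* + 4 ℤ.≤ + suc m
/≤¼⇒*4≤ z m le with ℚᵘ.≤-respˡ-≃ (toℚᵘ-/ z m) (ℚ.toℚᵘ-mono-≤ le)
... | ℚᵘ.*≤* le′ = subst (z ℤ.* + 4 ℤ.≤_) (ℤ.*-identityˡ (+ suc m)) le′

edge-≟ : ∀ {n k} → DecidableEquality (Edge n k)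
edge-≟ = ≡-dec _≟ᶠ_ (≡-dec (≡-decᵛ ℤ._≟_) _≟ᶠ_)

module _ {k : ℕ} where

  Energy : Set
  Energy = Fin k → ℕ

  -- Levels are natural numbers, so a step exists only if no component becomes negative: the energy
  -- condition is built into the moves.
  record Step (f : Energy) (w : Vec ℤ k) (f′ : Energy) : Set where
    constructor mkStep
    field at : ∀ j → + f j ℤ.+ Vec.lookup w j ≡ + f′ j

  open Step public

  nonNegative? : ∀ z → Dec (∃ λ a → z ≡ + a)
  nonNegative? (+ a)    = yes (a , refl)
  nonNegative? -[1+ a ] = no λ { (_ , ()) }

  step? : ∀ f w → Dec (∃ λ f′ → Step f w f′)
  step? f w with all? (λ j → nonNegative? (+ f j ℤ.+ Vec.lookup w j))
  ... | yes p = yes ((λ j → proj₁ (p j)) , mkStep (λ j → proj₂ (p j)))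
  ... | no ¬p = no λ { (f′ , st) → ¬p (λ j → f′ j , at st j) }

module _ {k : ℕ} (I : Instance k) where
  open Instance I

  prefix-suc : ∀ (π : Play I) i → prefix I π (suc i) ≡ prefix I π i ∷ʳ π i
  prefix-suc π i = trans (cong (map π) (sym (upTo-∷ʳ i))) (map-++ π (upTo i) (i ∷ []))

  cur-∷ʳ : ∀ s h e → cur I s (h ∷ʳ e) ≡ tgt e
  cur-∷ʳ s []      e = refl
  cur-∷ʳ s (d ∷ h) e = cur-∷ʳ (tgt d) h e

  IsPath-∷ʳ : ∀ {s h e} → IsPath I s h → e ∈ edges → src e ≡ cur I s h → IsPath I s (h ∷ʳ e)
  IsPath-∷ʳ []ᵖ       e∈ eq = (e∈ , eq) ∷ᵖ []ᵖ
  IsPath-∷ʳ (x ∷ᵖ xs) e∈ eq = x ∷ᵖ IsPath-∷ʳ xs e∈ eq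

  cur-prefix : ∀ π → IsPlay I π → ∀ i → cur I init (prefix I π i) ≡ src (π i)
  cur-prefix π (src≡ , _)     zero    = sym src≡
  cur-prefix π (_    , moves) (suc i) =
    trans (cong (cur I init) (prefix-suc π i)) (trans (cur-∷ʳ init (prefix I π i) (π i)) (proj₂ (moves i)))

  Owned : Bool → Fin n → Set
  Owned b s = Vec.lookup owner s ≡ b

module Attractor {k : ℕ} (I : Instance k) (wf : WellFormed I) where
  open Instance I
  open DecMembership (edge-≟ {n} {k}) using (_∈?_)

  -- A well-founded forcing tree for P₀: without any negative energy, play is driven in finitely
  -- many moves to a self-loop of weight 0 with all energies 0. The proof itself serves as the
  -- memory of the strategy.
  data Attracted : Fin n → Energy → Set where
    rest  : ∀ {s f} e → Owned I true s → e ∈ edges → src e ≡ s → tgt e ≡ s →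
            (∀ j → Vec.lookup (wt e) j ≡ + 0) → (∀ j → f j ≡ 0) → Attracted s f
    move  : ∀ {s f} e {f′} → Owned I true s → e ∈ edges → src e ≡ s →
            Step f (wt e) f′ → Attracted (tgt e) f′ → Attracted s f
    reply : ∀ {s f} → Owned I false s →
            (∀ e → e ∈ edges → src e ≡ s → ∃ λ f′ → Step f (wt e) f′ × Attracted (tgt e) f′) →
            Attracted s f

  Node : Set
  Node = ∃₂ Attracted

  child : Node → Edge n k → Node
  child x@(_ , _ , rest _ _ _ _ _ _ _)       _ = x
  child (_ , _ , move e {f′} _ _ _ _ a)      _ = tgt e , f′ , a
  child x@(s , _ , reply _ g) e with e ∈? edges | src e ≟ᶠ s
  ... | yes e∈ | yes eq = tgt e , proj₁ (g e e∈ eq) , proj₂ (proj₂ (g e e∈ eq))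
  -- Default for edges that do not leave `s`; no play that follows the tree gets here.
  ... | _      | _      = x

  -- The proofs in the result are those found by the decision procedures inside `child`; with
  -- repeated edges they may differ from the given ones, hence the existential.
  child-reply : ∀ {s f e} own g → e ∈ edges → src e ≡ s → ∃₂ λ e∈ eq →
                child (s , f , reply own g) e ≡ (tgt e , proj₁ (g e e∈ eq) , proj₂ (proj₂ (g e e∈ eq)))
  child-reply {s} {e = e} own g e∈ eq with e ∈? edges | src e ≟ᶠ s
  ... | yes e∈′ | yes eq′ = e∈′ , eq′ , refl
  ... | no e∉   | _       = contradiction e∈ e∉
  ... | yes _   | no ≢s   = contradiction eq ≢s

  proposal : (x : Node) → ∃ λ e → e ∈ edges × src e ≡ proj₁ x
  proposal (_ , _ , rest e _ e∈ eq _ _ _) = e , e∈ , eq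
  proposal (_ , _ , move e _ e∈ eq _ _)   = e , e∈ , eq
  proposal (s , _ , reply _ _)            = wf s

  -- A valid strategy must answer every history that is a path, also those that stray from the tree;
  -- these get the default edge of `wf`.
  select : Node → (s : Fin n) → ∃ λ e → e ∈ edges × src e ≡ s
  select x s with proj₁ x ≟ᶠ s
  ... | yes refl = proposal x
  ... | no _     = wf s

  select-proposal : ∀ x → proj₁ (select x (proj₁ x)) ≡ proj₁ (proposal x)
  select-proposal x with proj₁ x ≟ᶠ proj₁ x
  ... | yes refl = refl
  ... | no ¬eq   = contradiction refl ¬eq

  module _ (thr≡0 : ∀ j → Vec.lookup thr j ≡ 0ℚ) (root : Attracted init (λ _ → 0)) where

    walk : List (Edge n k) → Node
    walk = foldl child (init , (λ _ → 0) , root)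

    σ : Strategy I
    σ h = proj₁ (select (walk h) (cur I init h))

    module _ (π : Play I) (play : IsPlay I π) (con : Consistent I σ π) where

      node : ℕ → Node
      node i = walk (prefix I π i)

      node-suc : ∀ i → node (suc i) ≡ child (node i) (π i)
      node-suc i = trans (cong walk (prefix-suc I π i)) (foldl-∷ʳ child _ (π i) (prefix I π i))

      Tracks : ℕ → Node → Set
      Tracks i (s , f , _) = src (π i) ≡ s × (∀ j → energy I π j i ≡ + f j)

      follows : ∀ i x → node i ≡ x → Owned I true (proj₁ x) → src (π i) ≡ proj₁ x →
                π i ≡ proj₁ (proposal x)
      follows i x refl own eq = trans (con i (trans (cong (Vec.lookup owner) eq) own))
        (trans (cong (proj₁ ∘ select x) (trans (cur-prefix I π play i) eq)) (select-proposal x))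

      tracks-child : ∀ i x → node i ≡ x → Tracks i x → Tracks (suc i) (child x (π i))
      tracks-child i x@(s , f , rest e own e∈ eq loop w≡0 f≡0) nd (src≡ , en)
        with πi ← follows i x nd own src≡ =
          trans (sym (proj₂ (proj₂ play i))) (trans (cong tgt πi) loop)
        , λ j → trans (cong₂ ℤ._+_ (en j) (trans (cong (λ e → Vec.lookup (wt e) j) πi) (w≡0 j))) (ℤ.+-identityʳ _)
      tracks-child i x@(s , f , move e own e∈ eq st a) nd (src≡ , en)
        with πi ← follows i x nd own src≡ =
          trans (sym (proj₂ (proj₂ play i))) (cong tgt πi)
        , λ j → trans (cong₂ ℤ._+_ (en j) (cong (λ e → Vec.lookup (wt e) j) πi)) (at st j)
      tracks-child i (s , f , reply own g) nd (src≡ , en) with π i ∈? edges | src (π i) ≟ᶠ s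
      ... | yes e∈ | yes eq = sym (proj₂ (proj₂ play i))
                            , λ j → trans (cong (ℤ._+ _) (en j)) (at (proj₁ (proj₂ (g (π i) e∈ eq))) j)
      ... | no e∉  | _      = contradiction (proj₁ (proj₂ play i)) e∉
      ... | yes _  | no ≢s  = contradiction src≡ ≢s

      tracks : ∀ i → Tracks i (node i)
      tracks zero    = proj₁ play , λ j → refl
      tracks (suc i) = subst (Tracks (suc i)) (sym (node-suc i)) (tracks-child i (node i) refl (tracks i))

      Resting : Node → Set
      Resting x@(_ , f , _) = (∀ e → child x e ≡ x) × (∀ j → f j ≡ 0)

      -- Every edge of the play descends to a subtree of the forcing tree, so structural recursion
      -- on the tree terminates at a leaf.
      eventually-rests : ∀ i {s f} (a : Attracted s f) → node i ≡ (s , f , a) → ∃ λ t → Resting (node t)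
      eventually-rests i (rest e _ _ _ _ _ f≡0) nd = i , subst Resting (sym nd) ((λ _ → refl) , f≡0)
      eventually-rests i (move e _ _ _ _ a) nd =
        eventually-rests (suc i) a (trans (node-suc i) (cong (λ x → child x (π i)) nd))
      eventually-rests i (reply own g) nd
        with e∈ , eq , ch ← child-reply own g (proj₁ (proj₂ play i))
                              (subst (src (π i) ≡_) (cong proj₁ nd) (proj₁ (tracks i))) =
        eventually-rests (suc i) (proj₂ (proj₂ (g (π i) e∈ eq)))
          (trans (node-suc i) (trans (cong (λ x → child x (π i)) nd) ch))

      energyOK : EnergyOK I π
      energyOK i _ j = subst (+ 0 ℤ.≤_) (sym (proj₂ (tracks i) j)) (ℤ.+≤+ z≤n)

      module _ (t : ℕ) (resting : Resting (node t)) where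

        node-constant : ∀ m → node (m + t) ≡ node t
        node-constant zero    = refl
        node-constant (suc m) = trans (node-suc (m + t))
          (trans (cong (λ x → child x (π (m + t))) (node-constant m)) (proj₁ resting _))

        energy≡0 : ∀ m j → energy I π j (m + t) ≡ + 0
        energy≡0 m j = trans (proj₂ (tracks (m + t)) j)
          (cong +_ (trans (cong (λ x → proj₁ (proj₂ x) j) (node-constant m)) (proj₂ resting j)))

        sumEnergy-constant : ∀ m j → sumEnergy I π j (m + t) ≡ sumEnergy I π j t
        sumEnergy-constant zero    j = refl
        sumEnergy-constant (suc m) j =
          trans (cong₂ ℤ._+_ (sumEnergy-constant m j) (energy≡0 (suc m) j)) (ℤ.+-identityʳ _)

        sumEnergy-nonneg : ∀ m j → ∃ λ c → sumEnergy I π j m ≡ + c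
        sumEnergy-nonneg zero    j = 0 , refl
        sumEnergy-nonneg (suc m) j with c , eq ← sumEnergy-nonneg m j =
          c + proj₁ (proj₂ (node (suc m))) j , cong₂ ℤ._+_ eq (proj₂ (tracks (suc m)) j)

        limsupAEOK : LimsupAEOK I π
        limsupAEOK j ε pos with c , sum≡ ← sumEnergy-nonneg t j with N , bound ← /-eventually≤ c ε pos =
          -- From `t` on the energies are 0 and the sum is frozen at `c`; beyond `N` the quotient
          -- `c / (m + 1)` is within `ε`.
          N ⊔ t , λ m le → subst₂ ℚ._≤_ (cong (ℚ._/ suc m) (sym (late m (m⊔n≤o⇒n≤o N t le))))
                                  (cong (ℚ._+ ε) (sym (thr≡0 j))) (bound m (m⊔n≤o⇒m≤o N t le))
          where
          late : ∀ m → t ≤ m → sumEnergy I π j (suc m) ≡ + c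
          late m t≤m = trans (cong (sumEnergy I π j) (sym (m∸n+n≡m (m≤n⇒m≤1+n t≤m))))
                             (trans (sumEnergy-constant (suc m ∸ t) j) sum≡)

      inAEL : InAEL I π
      inAEL = energyOK , let t , resting = eventually-rests 0 root refl in limsupAEOK t resting

    attracted⇒winning : Winning I
    attracted⇒winning = σ , (λ h _ _ → proj₂ (select (walk h) (cur I init h))) , inAEL

-- The dual tool: `R` is an invariant that P₁ can maintain for as long as no energy is negative. It
-- keeps the sum of the energies `j₀` and `j₁` at least 1 after every step, so their averages cannot
-- both have limsup at most 0.
module Trap {k : ℕ} (I : Instance k) (wf : WellFormed I)
  (R : Fin (Instance.n I) → Energy {k} → Set) (j₀ j₁ : Fin k) where
  open Instance I

  Keeps : Energy → Edge n k → Set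
  Keeps f e = ∀ f′ → Step f (wt e) f′ → R (tgt e) f′ × 1 ≤ f′ j₀ + f′ j₁

  Trapped : Fin n → Energy → Set
  Trapped s f = (∀ e → e ∈ edges → src e ≡ s → Keeps f e) ⊎
                (Owned I false s × ∃ λ e → e ∈ edges × src e ≡ s × Keeps f e)

  module _ (thr₀ : Vec.lookup thr j₀ ≡ 0ℚ) (thr₁ : Vec.lookup thr j₁ ≡ 0ℚ)
    (closed : ∀ s f → R s f → Trapped s f) (start : R init (λ _ → 0))
    (σ : Strategy I) (valid : ValidStrategy I σ) where

    -- The invariant is dropped (nothing) once some energy has become negative.
    record Node : Set where
      constructor mkNode
      field
        history : List (Edge n k)
        path    : IsPath I init history
        status  : Maybe (∃ (R (cur I init history)))

    open Node

    state : Node → Fin n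
    state x = cur I init (history x)

    Respects : ∀ {s} → Maybe (∃ (R s)) → Edge n k → Set
    Respects (just (f , _)) e = Keeps f e
    -- After a negative energy there is nothing left to keep; `e` itself inhabits this type.
    Respects nothing        e = Edge n k

    answer : ∀ s → Owned I false s → (r : Maybe (∃ (R s))) → ∃ λ e → e ∈ edges × src e ≡ s × Respects r e
    answer s own nothing = let e , e∈ , eq = wf s in e , e∈ , eq , e
    answer s own (just (f , r)) with closed s f r
    ... | inj₁ all                  = let e , e∈ , eq = wf s in e , e∈ , eq , all e e∈ eq
    ... | inj₂ (_ , e , e∈ , eq , ok) = e , e∈ , eq , ok

    respects : ∀ s → Owned I true s → (r : Maybe (∃ (R s))) → ∀ e → e ∈ edges → src e ≡ s → Respects r e
    respects s own nothing e _ _ = e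
    respects s own (just (f , r)) e e∈ eq with closed s f r
    ... | inj₁ all         = all e e∈ eq
    ... | inj₂ (own′ , _) with () ← trans (sym own) own′

    -- The play against the fixed `σ`: it takes the move of `σ` in states of P₀ and an
    -- invariant-keeping move in those of P₁.
    next : (x : Node) → ∃ λ e → e ∈ edges × src e ≡ state x × Respects (status x) e ×
                                (Owned I true (state x) → e ≡ σ (history x))
    next x with Vec.lookup owner (state x) in own
    ... | true  = let e∈ , eq = valid (history x) (path x) own in
      σ (history x) , e∈ , eq , respects (state x) own (status x) _ e∈ eq , λ _ → refl
    ... | false = let e , e∈ , eq , ok = answer (state x) own (status x) in e , e∈ , eq , ok , λ ()

    update-status : ∀ {s} (r : Maybe (∃ (R s))) e → Respects r e → Maybe (∃ (R (tgt e)))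
    update-status nothing        e ok = nothing
    update-status (just (f , _)) e ok with step? f (wt e)
    ... | yes (f′ , st) = just (f′ , proj₁ (ok f′ st))
    ... | no _          = nothing

    advance : Node → Node
    advance x = let e , e∈ , eq , ok , _ = next x in
      mkNode (history x ∷ʳ e) (IsPath-∷ʳ I (path x) e∈ eq)
             (subst (Maybe ∘ ∃ ∘ R) (sym (cur-∷ʳ I init (history x) e)) (update-status (status x) e ok))

    node : ℕ → Node
    node zero    = mkNode [] []ᵖ (just ((λ _ → 0) , start))
    node (suc i) = advance (node i)

    π : Play I
    π i = proj₁ (next (node i))

    history≡prefix : ∀ i → history (node i) ≡ prefix I π i
    history≡prefix zero    = refl
    history≡prefix (suc i) = trans (cong (_∷ʳ π i) (history≡prefix i)) (sym (prefix-suc I π i))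

    src-π : ∀ i → src (π i) ≡ state (node i)
    src-π i = proj₁ (proj₂ (proj₂ (next (node i))))

    isPlay : IsPlay I π
    isPlay = src-π 0 , λ i → proj₁ (proj₂ (next (node i)))
                           , trans (sym (cur-∷ʳ I init (history (node i)) (π i))) (sym (src-π (suc i)))

    consistent : Consistent I σ π
    consistent i own = trans (proj₂ (proj₂ (proj₂ (proj₂ (next (node i))))) (trans (cong (Vec.lookup owner) (sym (src-π i))) own))
                             (cong σ (history≡prefix i))

    module _ (energyOK : EnergyOK I π) where

      Alive : ℕ → ∀ {s} → Maybe (∃ (R s)) → Set
      Alive i r = ∃ λ x → r ≡ just x × (∀ j → energy I π j i ≡ + proj₁ x j)

      alive-suc : ∀ i (r : Maybe (∃ (R (state (node i))))) (ok : Respects r (π i)) → Alive i r →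
                  ∃ λ x → update-status r (π i) ok ≡ just x × (∀ j → energy I π j (suc i) ≡ + proj₁ x j) ×
                          1 ≤ proj₁ x j₀ + proj₁ x j₁
      alive-suc i (just (f , r)) ok (_ , refl , en) with step? f (wt (π i))
      ... | yes (f′ , st) = (f′ , proj₁ (ok f′ st)) , refl
                          , (λ j → trans (cong (ℤ._+ Vec.lookup (wt (π i)) j) (en j)) (at st j)) , proj₂ (ok f′ st)
      -- Under `energyOK` the new energies are natural numbers, so a step does exist and the
      -- invariant is never dropped.
      ... | no ¬st = contradiction ((λ j → proj₁ (nat j)) , mkStep (λ j → trans (cong (ℤ._+ Vec.lookup (wt (π i)) j) (sym (en j))) (proj₂ (nat j)))) ¬st
        where
        nat : ∀ j → ∃ λ a → energy I π j (suc i) ≡ + a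
        nat j with energy I π j (suc i) | energyOK (suc i) (s≤s z≤n) j
        ... | + a | _ = a , refl

      alive-subst : ∀ i {s s′} (eq : s ≡ s′) (r : Maybe (∃ (R s))) → Alive i r → Alive i (subst (Maybe ∘ ∃ ∘ R) eq r)
      alive-subst i refl r al = al

      alive : ∀ i → Alive i (status (node i))
      alive zero    = _ , refl , λ j → refl
      alive (suc i) with x , eq , en , _ ← alive-suc i (status (node i)) (proj₁ (proj₂ (proj₂ (proj₂ (next (node i)))))) (alive i) =
        alive-subst (suc i) (sym (cur-∷ʳ I init (history (node i)) (π i))) _ (x , eq , en)

      energies≥1 : ∀ i → + 1 ℤ.≤ energy I π j₀ (suc i) ℤ.+ energy I π j₁ (suc i)
      energies≥1 i with x , _ , en , pos ← alive-suc i (status (node i)) (proj₁ (proj₂ (proj₂ (proj₂ (next (node i)))))) (alive i) =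
        subst (+ 1 ℤ.≤_) (sym (cong₂ ℤ._+_ (en j₀) (en j₁))) (ℤ.+≤+ pos)

      sums≥ : ∀ m → + m ℤ.≤ sumEnergy I π j₀ m ℤ.+ sumEnergy I π j₁ m
      sums≥ zero    = ℤ.≤-refl
      sums≥ (suc m) = ℤ.≤-trans (ℤ.≤-reflexive (cong +_ (+-comm 1 m)))
        (ℤ.≤-trans (ℤ.+-mono-≤ (sums≥ m) (energies≥1 m))
                   (ℤ.≤-reflexive (interchange (sumEnergy I π j₀ m) _ _ _)))

      -- The two averages add up to at least 1, whereas `ε = 1/4` would eventually bound each of
      -- them by 1/4. Cleared of denominators this reads `4 n ≤ 2 n` for `n = suc m`.
      ¬limsupAEOK : ¬ LimsupAEOK I π
      ¬limsupAEOK limsup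
        with N₀ , bound₀ ← limsup j₀ ((+ 1) ℚ./ 4) _
        with N₁ , bound₁ ← limsup j₁ ((+ 1) ℚ./ 4) _ = contradiction (ℤ.drop‿+≤+ 4m≤2m) (<⇒≱ 2m<4m)
        where
        m : ℕ
        m = N₀ ⊔ N₁
        quarter : ∀ j → Vec.lookup thr j ≡ 0ℚ → AE I π j m ℚ.≤ Vec.lookup thr j ℚ.+ (+ 1) ℚ./ 4 →
                  sumEnergy I π j (suc m) ℤ.* + 4 ℤ.≤ + suc m
        quarter j thr≡0 le = /≤¼⇒*4≤ (sumEnergy I π j (suc m)) m (subst (λ t → AE I π j m ℚ.≤ t ℚ.+ (+ 1) ℚ./ 4) thr≡0 le)
        4m≤2m : + (suc m * 4) ℤ.≤ + (suc m + suc m)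
        4m≤2m = ℤ.≤-trans (ℤ.≤-reflexive (ℤ.pos-* (suc m) 4))
          (ℤ.≤-trans (ℤ.*-monoʳ-≤-nonNeg (+ 4) (sums≥ (suc m)))
          (ℤ.≤-trans (ℤ.≤-reflexive (ℤ.*-distribʳ-+ (+ 4) (sumEnergy I π j₀ (suc m)) _))
                     (ℤ.+-mono-≤ (quarter j₀ thr₀ (bound₀ m (m≤m⊔n N₀ N₁))) (quarter j₁ thr₁ (bound₁ m (m≤n⊔m N₀ N₁))))))
        2m<4m : suc m + suc m < suc m * 4
        2m<4m = subst (_< suc m * 4) (trans (*-suc (suc m) 1) (cong (λ z → suc m + z) (*-identityʳ (suc m)))) (*-monoʳ-< (suc m) {2} {4} (s≤s (s≤s (s≤s z≤n))))

    σ-loses : ¬ (∀ π → IsPlay I π → Consistent I σ π → InAEL I π)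
    σ-loses wins = let energyOK , limsup = wins π isPlay consistent in ¬limsupAEOK energyOK limsup

  trapped⇒¬winning : Vec.lookup thr j₀ ≡ 0ℚ → Vec.lookup thr j₁ ≡ 0ℚ →
                     (∀ s f → R s f → Trapped s f) → R init (λ _ → 0) → ¬ Winning I
  trapped⇒¬winning thr₀ thr₁ closed start (σ , valid , wins) = σ-loses thr₀ thr₁ closed start σ valid wins

-- Games from successor lists

-- A retract of `Fin size` is enough: an index outside the image of `to` becomes a copy of the state
-- `from i` that no edge enters.
record Finite (A : Set) : Set where
  field
    size    : ℕ
    to      : A → Fin size
    from    : Fin size → A
    from∘to : ∀ a → from (to a) ≡ a

Fin-finite : ∀ n → Finite (Fin n)
Fin-finite n = record { size = n ; to = λ i → i ; from = λ i → i ; from∘to = λ _ → refl }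

Bool-finite : Finite Bool
Bool-finite = record
  { size = 2
  ; to   = λ { false → zero ; true → suc zero }
  ; from = λ { zero → false ; (suc _) → true }
  ; from∘to = λ { false → refl ; true → refl } }

retract-finite : ∀ {A B : Set} → Finite B → (f : A → B) (g : B → A) → (∀ a → g (f a) ≡ a) → Finite A
retract-finite B f g g∘f = record
  { size = size ; to = to ∘ f ; from = g ∘ from ; from∘to = λ a → trans (cong g (from∘to (f a))) (g∘f a) }
  where open Finite B

⊎-finite : ∀ {A B : Set} → Finite A → Finite B → Finite (A ⊎ B)
⊎-finite A B = record
  { size    = A.size + B.size
  ; to      = join A.size B.size ∘ Sum.map A.to B.to
  ; from    = Sum.map A.from B.from ∘ splitAt A.size
  ; from∘to = λ { (inj₁ a) → trans (cong (Sum.map A.from B.from) (splitAt-join A.size B.size (inj₁ (A.to a)))) (cong inj₁ (A.from∘to a))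
                ; (inj₂ b) → trans (cong (Sum.map A.from B.from) (splitAt-join A.size B.size (inj₂ (B.to b)))) (cong inj₂ (B.from∘to b)) } }
  where
  module A = Finite A
  module B = Finite B

×-finite : ∀ {A B : Set} → Finite A → Finite B → Finite (A × B)
×-finite A B = record
  { size    = A.size * B.size
  ; to      = λ { (a , b) → combine (A.to a) (B.to b) }
  ; from    = λ i → let x , y = remQuot {A.size} B.size i in A.from x , B.from y
  ; from∘to = λ { (a , b) → trans (cong (λ (x , y) → A.from x , B.from y) (remQuot-combine (A.to a) (B.to b)))
                                  (cong₂ _,_ (A.from∘to a) (B.from∘to b)) } }
  where
  module A = Finite A
  module B = Finite B

Position-finite : ∀ c → Finite (Position c)
Position-finite (inc r)     = Fin-finite 1
Position-finite (c ； d)    = ⊎-finite (Position-finite c) (Position-finite d)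
Position-finite (while r c) = ⊎-finite (Fin-finite 1) (Position-finite c)
Position-finite (raw P)     = Fin-finite _

module Arena (k : ℕ) {S : Set} (finite : Finite S) (own : S → Bool)
  (out : S → List (Vec ℤ (2 + k) × S)) (exit : ∀ s → ∃ (_∈ out s)) (boot : S) where
  open Finite finite

  node : S → Fin (suc size)
  node s = suc (to s)

  arrow : Fin size → Vec ℤ (2 + k) × S → Edge (suc size) (2 + k)
  arrow i (w , t) = suc i , w , node t

  -- Built outside `Loaded`, hence independent of `v`. This independence is what later lets the seed
  -- describe its own game.
  laterEdges : List (Edge (suc size) (2 + k))
  laterEdges = concatMap (λ i → map (arrow i) (out (from i))) (allFin size)

  module Loaded (v : ℕ) where

    firstEdge : Edge (suc size) (2 + k)
    firstEdge = zero , + v ∷ Vec.replicate (suc k) (+ 0) , node boot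

    game : Instance (2 + k)
    game = record
      { n     = suc size
      ; owner = true ∷ Vec.tabulate (own ∘ from)
      ; edges = firstEdge ∷ laterEdges
      ; init  = zero
      ; thr   = Vec.replicate (2 + k) 0ℚ }

    open Instance game using (edges; owner)

    arrow∈ : ∀ i {x} → x ∈ out (from i) → arrow i x ∈ edges
    arrow∈ i x∈ = there (∈-concatMap⁺ (λ i → map (arrow i) (out (from i))) (lose (∈-allFin i) (∈-map⁺ (arrow i) x∈)))

    ∈arrow : ∀ i {e} → e ∈ edges → src e ≡ suc i → ∃ λ x → x ∈ out (from i) × e ≡ arrow i x
    ∈arrow i (here refl) ()
    ∈arrow i (there e∈) eq
      with j , _ , e∈′ ← find (∈-concatMap⁻ (λ i → map (arrow i) (out (from i))) {xs = allFin size} e∈)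
      with x , x∈ , refl ← ∈-map⁻ (arrow j) e∈′
      with refl ← suc-injectiveᶠ eq = x , x∈ , refl

    ∈first : ∀ {e} → e ∈ edges → src e ≡ zero → e ≡ firstEdge
    ∈first (here eq)  _  = eq
    ∈first (there e∈) eq
      with j , _ , e∈′ ← find (∈-concatMap⁻ (λ i → map (arrow i) (out (from i))) {xs = allFin size} e∈)
      with _ , _ , refl ← ∈-map⁻ (arrow j) e∈′
      with () ← eq

    arrow-node∈ : ∀ s {x} → x ∈ out s → arrow (to s) x ∈ edges
    arrow-node∈ s x∈ = arrow∈ (to s) (subst (λ s → _ ∈ out s) (sym (from∘to s)) x∈)

    ∈arrow-node : ∀ s {e} → e ∈ edges → src e ≡ node s → ∃ λ x → x ∈ out s × e ≡ arrow (to s) x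
    ∈arrow-node s e∈ eq with x , x∈ , refl ← ∈arrow (to s) e∈ eq = x , subst (λ s → x ∈ out s) (from∘to s) x∈ , refl

    wellFormed : WellFormed game
    wellFormed zero    = firstEdge , here refl , refl
    wellFormed (suc i) = let x , x∈ = exit (from i) in arrow i x , arrow∈ i x∈ , refl

    own-node : ∀ s → Vec.lookup owner (node s) ≡ own s
    own-node s = trans (lookup∘tabulate (own ∘ from) (to s)) (cong own (from∘to s))

    open Attractor game wellFormed using (Attracted; rest; move; reply; attracted⇒winning)

    record W (s : S) (f : Energy) : Set where
      constructor mkW
      field attracted : Attracted (node s) f

    open W

    W-rest : ∀ {s f} → own s ≡ true → (Vec.replicate (2 + k) (+ 0) , s) ∈ out s → (∀ j → f j ≡ 0) → W s f
    W-rest {s} o x∈ f≡0 = mkW (rest (arrow (to s) _) (trans (own-node s) o) (arrow-node∈ s x∈) refl refl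
      (λ j → lookup-replicate j (+ 0)) f≡0)

    W-move : ∀ {s f w t f′} → own s ≡ true → (w , t) ∈ out s → Step f w f′ → W t f′ → W s f
    W-move {s} o x∈ st a = mkW (move (arrow (to s) _) (trans (own-node s) o) (arrow-node∈ s x∈) refl st (attracted a))

    W-reply : ∀ {s f} → own s ≡ false → All (λ (w , t) → ∃ λ f′ → Step f w f′ × W t f′) (out s) → W s f
    W-reply {s} {f} o all = mkW (reply (trans (own-node s) o) answer)
      where
      answer : ∀ e → e ∈ edges → src e ≡ node s → ∃ λ f′ → Step f (wt e) f′ × Attracted (tgt e) f′
      answer e e∈ eq with x , x∈ , refl ← ∈arrow-node s e∈ eq =
        let f′ , st , a = All.lookup all x∈ in f′ , st , attracted a

    initial-step : ∀ f → f zero ≡ v → (∀ j → f (suc j) ≡ 0) → Step (λ _ → 0) (wt firstEdge) f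
    initial-step f f₀ f≡0 .at zero    = cong +_ (sym f₀)
    initial-step f f₀ f≡0 .at (suc j) = trans (cong (λ z → + 0 ℤ.+ z) (lookup-replicate j (+ 0))) (cong +_ (sym (f≡0 j)))

    W⇒winning : ∀ {f} → f zero ≡ v → (∀ j → f (suc j) ≡ 0) → W boot f → Winning game
    W⇒winning {f} f₀ f≡0 a = attracted⇒winning (λ j → lookup-replicate j 0ℚ)
      (move firstEdge refl (here refl) refl (initial-step f f₀ f≡0) (attracted a))

    module _ (R : S → Energy {2 + k} → Set) where

      Keeps′ : Energy → Vec ℤ (2 + k) × S → Set
      Keeps′ f (w , t) = ∀ f′ → Step f w f′ → R t f′ × 1 ≤ f′ zero + f′ (suc zero)

      R̂ : Fin (suc size) → Energy → Set
      R̂ zero    f = ∀ j → f j ≡ 0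
      R̂ (suc i) f = R (from i) f

      open Trap game wellFormed R̂ zero (suc zero) using (Keeps; Trapped; trapped⇒¬winning)

      keeps-arrow : ∀ i f x → Keeps′ f x → Keeps f (arrow i x)
      keeps-arrow i f (_ , t) ok f′ st = let r , pos = ok f′ st in subst (λ s → R s f′) (sym (from∘to t)) r , pos

      -- The invariant is extended to the fresh initial state by asking for energies 0 there; its
      -- only edge loads `v ≥ 1`, so the total is positive from the first step on.
      invariant⇒¬winning :
        1 ≤ v → (∀ f → f zero ≡ v → (∀ j → f (suc j) ≡ 0) → R boot f) →
        (∀ s f → R s f → All (Keeps′ f) (out s) ⊎ (own s ≡ false × Any (Keeps′ f) (out s))) →
        ¬ Winning game
      invariant⇒¬winning v≥1 start closed = trapped⇒¬winning refl refl trapped (λ _ → refl)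
        where
        trapped : ∀ s f → R̂ s f → Trapped s f
        trapped zero f f≡0 = inj₁ first
          where
          first : ∀ e → e ∈ edges → src e ≡ zero → Keeps f e
          first e e∈ eq f′ st with refl ← ∈first e∈ eq =
            subst (λ s → R s f′) (sym (from∘to boot)) (start f′ f′₀ f′≡0)
            , ≤-trans v≥1 (≤-trans (≤-reflexive (sym f′₀)) (m≤m+n (f′ zero) (f′ (suc zero))))
            where
            f′₀ : f′ zero ≡ v
            f′₀ = sym (ℤ.+-injective (trans (cong (λ a → + a ℤ.+ + v) (sym (f≡0 zero))) (at st zero)))
            f′≡0 : ∀ j → f′ (suc j) ≡ 0
            f′≡0 j = sym (ℤ.+-injective (trans (cong₂ (λ a z → + a ℤ.+ z) (sym (f≡0 (suc j))) (sym (lookup-replicate j (+ 0)))) (at st (suc j))))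
        trapped (suc i) f r with closed (from i) f r
        ... | inj₁ all = inj₁ keeps
          where
          keeps : ∀ e → e ∈ edges → src e ≡ suc i → Keeps f e
          keeps e e∈ eq with x , x∈ , refl ← ∈arrow i e∈ eq = keeps-arrow i f x (All.lookup all x∈)
        ... | inj₂ (o , any) with x , x∈ , ok ← find any =
          inj₂ (trans (lookup∘tabulate (own ∘ from) i) o , arrow i x , arrow∈ i x∈ , refl , keeps-arrow i f x ok)

-- The two energies play symmetric roles: d tells which coordinate is the
-- active one, and levels and weights list the active coordinate first.

module _ {k : ℕ} where

  coordinate : Bool → Fin (2 + k)
  coordinate false = zero
  coordinate true  = suc zero

  levels : ℕ → ℕ → Energy {2 + k}
  levels a b zero          = a
  levels a b (suc zero)    = b
  -- All further coordinates stay 0, so two energies serve every dimension from 2 on.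
  levels a b (suc (suc _)) = 0

  level : Bool → ℕ → ℕ → Energy {2 + k}
  level false a b = levels a b
  level true  a b = levels b a

  weights : ℤ → ℤ → Vec ℤ (2 + k)
  weights x y = x ∷ y ∷ Vec.replicate k (+ 0)

  weight : Bool → ℤ → ℤ → Vec ℤ (2 + k)
  weight false x y = weights x y
  weight true  x y = weights y x

  idle : Vec ℤ (2 + k)
  idle = Vec.replicate (2 + k) (+ 0)

  level-not : ∀ d a b → level (not d) a b ≡ level d b a
  level-not false a b = refl
  level-not true  a b = refl

  levels-step : ∀ {a b x y a′ b′} → + a ℤ.+ x ≡ + a′ → + b ℤ.+ y ≡ + b′ →
                Step (levels a b) (weights x y) (levels a′ b′)
  levels-step p q .at zero          = p
  levels-step p q .at (suc zero)    = q
  levels-step p q .at (suc (suc j)) = cong (λ z → + 0 ℤ.+ z) (lookup-replicate j (+ 0))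

  level-step : ∀ d {a b x y a′ b′} → + a ℤ.+ x ≡ + a′ → + b ℤ.+ y ≡ + b′ →
               Step (level d a b) (weight d x y) (level d a′ b′)
  level-step false p q = levels-step p q
  level-step true  p q = levels-step q p

  idle-step : ∀ f → Step f idle f
  idle-step f .at j = trans (cong (λ z → + f j ℤ.+ z) (lookup-replicate j (+ 0))) (ℤ.+-identityʳ _)

  step-idle : ∀ {f f′} → Step f idle f′ → ∀ j → f′ j ≡ f j
  step-idle {f} st j = ℤ.+-injective (trans (sym (at st j)) (at (idle-step f) j))

  step-active : ∀ d {x y f f′} → Step f (weight d x y) f′ → + f (coordinate d) ℤ.+ x ≡ + f′ (coordinate d)
  step-active false st = at st zero
  step-active true  st = at st (suc zero)

  step-passive : ∀ d {x y f f′} → Step f (weight d x y) f′ →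
                 + f (coordinate (not d)) ℤ.+ y ≡ + f′ (coordinate (not d))
  step-passive false st = at st (suc zero)
  step-passive true  st = at st zero

  total≥1 : ∀ d (f : Energy {2 + k}) → 1 ≤ f (coordinate d) + f (coordinate (not d)) → 1 ≤ f zero + f (suc zero)
  total≥1 false f p = p
  total≥1 true  f p = ≤-trans p (≤-reflexive (+-comm (f (suc zero)) (f zero)))

subtract : ∀ c a → + (c + a) ℤ.+ ℤ.- (+ c) ≡ + a
subtract c a = begin
  + (c + a) ℤ.+ ℤ.- (+ c)         ≡⟨ cong (λ n → + n ℤ.+ ℤ.- (+ c)) (+-comm c a) ⟩
  + a ℤ.+ + c ℤ.+ ℤ.- (+ c)       ≡⟨ ℤ.+-assoc (+ a) (+ c) (ℤ.- (+ c)) ⟩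
  + a ℤ.+ (+ c ℤ.+ ℤ.- (+ c))     ≡⟨ cong (λ z → + a ℤ.+ z) (ℤ.+-inverseʳ (+ c)) ⟩
  + a ℤ.+ + 0                     ≡⟨ ℤ.+-identityʳ (+ a) ⟩
  + a                             ∎
  where open ≡-Reasoning

subtracted : ∀ c {a a′} → + a ℤ.+ ℤ.- (+ c) ≡ + a′ → a ≡ c + a′
subtracted c {a} {a′} eq = ℤ.+-injective (begin
  + a                              ≡⟨ sym (ℤ.+-identityʳ (+ a)) ⟩
  + a ℤ.+ + 0                      ≡⟨ cong (λ z → + a ℤ.+ z) (sym (ℤ.+-inverseˡ (+ c))) ⟩
  + a ℤ.+ (ℤ.- (+ c) ℤ.+ + c)      ≡⟨ sym (ℤ.+-assoc (+ a) (ℤ.- (+ c)) (+ c)) ⟩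
  + a ℤ.+ ℤ.- (+ c) ℤ.+ + c        ≡⟨ cong (ℤ._+ + c) eq ⟩
  + (a′ + c)                       ≡⟨ cong +_ (+-comm a′ c) ⟩
  + (c + a′)                       ∎)
  where open ≡-Reasoning

-- From machines to games

module _ {X : Set} where

  register : Operation X → ℕ
  register (inc r _)   = r
  register (dec r _ _) = r

  -- `base o` reduces to `suc (basePred o)`, so the nonzero remainders modulo the base are the
  -- `suc i` with `i < basePred o`.
  base basePred : Operation X → ℕ
  base     o = sylvester (register o)
  basePred o = sylvesterProduct (register o)

  loss gain : Operation X → ℕ
  loss (inc _ _)   = 1
  loss (dec r _ _) = sylvester r
  gain (inc r _)   = sylvester r
  gain (dec _ _ _) = 1

  after otherwise : Operation X → X
  after (inc _ l)       = l
  after (dec _ l _)     = l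
  -- A filler: `options` leads to `doubt` only for `dec`.
  otherwise (inc _ l)   = l
  otherwise (dec _ _ l) = l

  gain≥1 : ∀ o → 1 ≤ gain o
  gain≥1 (inc _ _)   = s≤s z≤n
  gain≥1 (dec _ _ _) = s≤s z≤n

-- At choose the active energy is the Gödel number of the registers and the
-- passive energy is 0.  The loop at scale moves the active energy, divided by
-- loss and multiplied by gain, to the passive side; at check the opponent may
-- punish an incomplete transfer, at doubt a wrong claim that a register is 0
-- (disproved by a remainder of the active energy modulo the base at refute).

data State (Q : Set) : Set where
  boot halted : State Q
  sink        : Bool → State Q
  choose scale check doubt refute : Q → Bool → State Q

State-finite : ∀ {Q} → Finite Q → Finite (State Q)
State-finite {Q} finite = retract-finite
  (⊎-finite (Fin-finite 1) (⊎-finite (Fin-finite 1) (⊎-finite Bool-finite (×-finite (Fin-finite 5) (×-finite finite Bool-finite)))))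
  f g g∘f
  where
  Sum : Set
  Sum = Fin 1 ⊎ Fin 1 ⊎ Bool ⊎ Fin 5 × Q × Bool
  f : State Q → Sum
  f boot         = inj₁ zero
  f halted       = inj₂ (inj₁ zero)
  f (sink d)     = inj₂ (inj₂ (inj₁ d))
  f (choose q d) = inj₂ (inj₂ (inj₂ (zero , q , d)))
  f (scale q d)  = inj₂ (inj₂ (inj₂ (suc zero , q , d)))
  f (check q d)  = inj₂ (inj₂ (inj₂ (suc (suc zero) , q , d)))
  f (doubt q d)  = inj₂ (inj₂ (inj₂ (suc (suc (suc zero)) , q , d)))
  f (refute q d) = inj₂ (inj₂ (inj₂ (suc (suc (suc (suc zero))) , q , d)))
  g : Sum → State Q
  g (inj₁ _)                                                      = boot
  g (inj₂ (inj₁ _))                                               = halted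
  g (inj₂ (inj₂ (inj₁ d)))                                        = sink d
  g (inj₂ (inj₂ (inj₂ (zero , q , d))))                           = choose q d
  g (inj₂ (inj₂ (inj₂ (suc zero , q , d))))                       = scale q d
  g (inj₂ (inj₂ (inj₂ (suc (suc zero) , q , d))))                 = check q d
  g (inj₂ (inj₂ (inj₂ (suc (suc (suc zero)) , q , d))))           = doubt q d
  g (inj₂ (inj₂ (inj₂ (suc (suc (suc (suc _))) , q , d))))        = refute q d
  g∘f : ∀ s → g (f s) ≡ s
  g∘f boot         = refl
  g∘f halted       = refl
  g∘f (sink d)     = refl
  g∘f (choose q d) = refl
  g∘f (scale q d)  = refl
  g∘f (check q d)  = refl
  g∘f (doubt q d)  = refl
  g∘f (refute q d) = refl

module Reduction (k : ℕ) {Q : Set} (finite : Finite Q) (instr : Q → Operation (Maybe Q))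
  (start : Maybe Q) where
  open Machine Q instr

  goto : Maybe Q → Bool → State Q
  goto nothing  d = halted
  goto (just q) d = choose q d

  own : State Q → Bool
  own (check _ _) = false
  own (doubt _ _) = false
  own _           = true

  options : Operation (Maybe Q) → Q → Bool → List (Vec ℤ (2 + k) × State Q)
  options (inc _ _)   q d = (idle , scale q d) ∷ []
  options (dec _ _ _) q d = (idle , scale q d) ∷ (idle , doubt q d) ∷ []

  out : State Q → List (Vec ℤ (2 + k) × State Q)
  out boot         = (idle , goto start false) ∷ []
  -- Here both energies can be drained, after which P₀ idles at 0.
  out halted       = (idle , halted) ∷ (weight false (ℤ.- (+ 1)) (+ 0) , halted)
                   ∷ (weight true (ℤ.- (+ 1)) (+ 0) , halted) ∷ []
  -- Only the passive energy can be drained; a positive active energy remains forever.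
  out (sink d)     = (idle , sink d) ∷ (weight d (+ 0) (ℤ.- (+ 1)) , sink d) ∷ []
  out (choose q d) = options (instr q) q d
  out (scale q d)  = (weight d (ℤ.- (+ loss (instr q))) (+ gain (instr q)) , scale q d) ∷ (idle , check q d) ∷ []
  out (check q d)  = (idle , sink d) ∷ (idle , goto (after (instr q)) (not d)) ∷ []
  out (doubt q d)  = (idle , refute q d) ∷ (idle , goto (otherwise (instr q)) d) ∷ []
  -- Division with remainder: P₀ empties the active energy only by exiting with its nonzero
  -- remainder. The +1 on the passive side keeps the total positive when the last subtraction leaves
  -- 0.
  out (refute q d) = (weight d (ℤ.- (+ base (instr q))) (+ 1) , refute q d)
                   ∷ applyUpTo (λ i → weight d (ℤ.- (+ suc i)) (+ 0) , sink d) (basePred (instr q))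

  exit : ∀ s → ∃ (_∈ out s)
  exit boot         = _ , here refl
  exit halted       = _ , here refl
  exit (sink d)     = _ , here refl
  exit (choose q d) with instr q
  ... | inc _ _     = _ , here refl
  ... | dec _ _ _   = _ , here refl
  exit (scale q d)  = _ , here refl
  exit (check q d)  = _ , here refl
  exit (doubt q d)  = _ , here refl
  exit (refute q d) = _ , here refl

  open Arena k (State-finite finite) own out exit boot public

  module _ (xs₀ : Registers) where
    open Loaded (goedel xs₀)

    level-zero : ∀ d j → level {k} d 0 0 j ≡ 0
    level-zero false zero          = refl
    level-zero false (suc zero)    = refl
    level-zero false (suc (suc j)) = refl
    level-zero true  zero          = refl
    level-zero true  (suc zero)    = refl
    level-zero true  (suc (suc j)) = refl

    stays : ∀ n → + n ℤ.+ + 0 ≡ + n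
    stays n = ℤ.+-identityʳ (+ n)

    win-halted : ∀ a b → W halted (levels a b)
    win-halted zero    zero    = W-rest refl (here refl) (level-zero false)
    win-halted (suc a) b       = W-move refl (there (here refl)) (level-step false (subtract 1 a) (stays b)) (win-halted a b)
    win-halted zero    (suc b) = W-move refl (there (there (here refl))) (level-step true (subtract 1 b) refl) (win-halted zero b)

    win-sink : ∀ d b → W (sink d) (level d 0 b)
    win-sink d zero    = W-rest refl (here refl) (level-zero d)
    win-sink d (suc b) = W-move refl (there (here refl)) (level-step d refl (subtract 1 b)) (win-sink d b)

    win-scale : ∀ q d m b → W (check q d) (level d 0 (m * gain (instr q) + b)) →
                W (scale q d) (level d (m * loss (instr q)) b)
    win-scale q d zero    b w = W-move refl (there (here refl)) (idle-step _) w
    win-scale q d (suc m) b w = W-move refl (here refl)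
      (level-step d (subtract (loss (instr q)) (m * loss (instr q))) refl)
      (win-scale q d m (b + gain (instr q))
        (subst (W (check q d) ∘ level d 0) (shift (gain (instr q)) (m * gain (instr q)) b) w))
      where
      shift : ∀ g n b → g + n + b ≡ n + (b + g)
      shift = solve-∀

    win-refute : ∀ q d m i b → i < basePred (instr q) →
                 W (refute q d) (level d (m * base (instr q) + suc i) b)
    win-refute q d zero    i b lt = W-move refl
      (there (∈-applyUpTo⁺ (λ i → weight d (ℤ.- (+ suc i)) (+ 0) , sink d) lt))
      (level-step d (trans (cong (λ n → + n ℤ.+ ℤ.- (+ suc i)) (sym (+-identityʳ (suc i)))) (subtract (suc i) 0)) (stays b))
      (win-sink d b)
    win-refute q d (suc m) i b lt = W-move refl (here refl)
      (level-step d (trans (cong (λ n → + n ℤ.+ ℤ.- (+ base (instr q))) (+-assoc (base (instr q)) (m * base (instr q)) (suc i)))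
                           (subtract (base (instr q)) (m * base (instr q) + suc i))) refl)
      (win-refute q d m i (b + 1) lt)

    win-check : ∀ q d b → W (goto (after (instr q)) (not d)) (level (not d) b 0) → W (check q d) (level d 0 b)
    win-check q d b w = W-reply refl
      ( (level d 0 b , idle-step _ , win-sink d b)
      ∷ (level d 0 b , idle-step _ , subst (W (goto (after (instr q)) (not d))) (level-not d b 0) w) ∷ [])

    win-transfer : ∀ q d m → W (goto (after (instr q)) (not d)) (level (not d) (m * gain (instr q)) 0) →
                   W (scale q d) (level d (m * loss (instr q)) 0)
    win-transfer q d m w = win-scale q d m 0
      (win-check q d _ (subst (λ b → W (goto (after (instr q)) (not d)) (level (not d) b 0)) (sym (+-identityʳ _)) w))

    scale∈ : ∀ o q d → (idle , scale q d) ∈ options o q d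
    scale∈ (inc _ _)   q d = here refl
    scale∈ (dec _ _ _) q d = here refl

    doubt∈ : ∀ {o r l₁ l₂} → o ≡ dec r l₁ l₂ → ∀ q d → (idle , doubt q d) ∈ options o q d
    doubt∈ refl q d = there (here refl)

    not-divisible : ∀ p n → ¬ (suc p ∣ n) → ∃₂ λ m i → i < p × n ≡ m * suc p + suc i
    not-divisible p n ∤ with n % suc p in eq
    ... | zero  = contradiction (m%n≡0⇒n∣m n (suc p) eq) ∤
    ... | suc i = n / suc p , i , ≤-pred (subst (_< suc p) eq (m%n<n n (suc p)))
                , trans (m≡m%n+[m/n]*n n (suc p)) (trans (cong (_+ n / suc p * suc p) eq) (+-comm (suc i) _))

    -- P₀ simulates faithfully, by induction on the halting run. An increment takes as many rounds
    -- of `scale` as the old Gödel number, a decrement as many as the new one; each empties the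
    -- active energy exactly. A true zero claim survives `refute` because division leaves a nonzero
    -- remainder.
    win : ∀ {l xs} → Halts (l , xs) → ∀ d → W (goto l d) (level d (goedel xs) 0)
    win {xs = xs} stop false = win-halted (goedel xs) 0
    win {xs = xs} stop true  = win-halted 0 (goedel xs)
    win {xs = xs} (step {q} h) d with instr q in eq
    ... | inc r l = W-move refl (scale∈ (instr q) q d) (idle-step _)
      (subst (λ a → W (scale q d) (level d a 0)) a≡
        (win-transfer q d (goedel xs) (subst₂ (λ l b → W (goto l (not d)) (level (not d) b 0)) l≡ b≡ (win h (not d)))))
      where
      a≡ : goedel xs * loss (instr q) ≡ goedel xs
      a≡ = trans (cong (λ o → goedel xs * loss o) eq) (*-identityʳ _)
      l≡ : l ≡ after (instr q)
      l≡ = cong after (sym eq)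
      b≡ : goedel (increment r xs) ≡ goedel xs * gain (instr q)
      b≡ = trans (goedel-increment r xs) (trans (*-comm (sylvester r) (goedel xs)) (cong (λ o → goedel xs * gain o) (sym eq)))
    ... | dec r l₁ l₂ with decrement r xs in de
    ...   | just ys = W-move refl (scale∈ (instr q) q d) (idle-step _)
      (subst (λ a → W (scale q d) (level d a 0)) a≡
        (win-transfer q d (goedel ys) (subst₂ (λ l b → W (goto l (not d)) (level (not d) b 0)) l≡ b≡ (win h (not d)))))
      where
      a≡ : goedel ys * loss (instr q) ≡ goedel xs
      a≡ = trans (cong (λ o → goedel ys * loss o) eq)
                 (trans (*-comm (goedel ys) (sylvester r)) (sym (goedel-decrement r xs de)))
      l≡ : l₁ ≡ after (instr q)
      l≡ = cong after (sym eq)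
      b≡ : goedel ys ≡ goedel ys * gain (instr q)
      b≡ = trans (sym (*-identityʳ _)) (cong (λ o → goedel ys * gain o) (sym eq))
    ...   | nothing = W-move refl (doubt∈ eq q d) (idle-step _)
      (W-reply refl
        ( (level d (goedel xs) 0 , idle-step _ , refuted)
        ∷ (level d (goedel xs) 0 , idle-step _ , subst (λ l → W (goto l d) (level d (goedel xs) 0)) (cong otherwise (sym eq)) (win h d))
        ∷ []))
      where
      refuted : W (refute q d) (level d (goedel xs) 0)
      refuted with m , i , lt , goedel≡ ← not-divisible (basePred (instr q)) (goedel xs)
                     (subst (λ o → ¬ (base o ∣ goedel xs)) (sym eq) (sylvester∤goedel r xs de)) =
        subst (λ a → W (refute q d) (level d a 0)) (sym goedel≡) (win-refute q d m i 0 lt)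

    halts⇒winning : Halts (start , xs₀) → Winning game
    halts⇒winning h = W⇒winning {level false (goedel xs₀) 0} refl level-suc
      (W-move refl (here refl) (idle-step _) (win h false))
      where
      level-suc : ∀ j → level {k} false (goedel xs₀) 0 (suc j) ≡ 0
      level-suc zero    = refl
      level-suc (suc j) = refl

    -- The invariant of P₁ when the machine diverges

    Holds : Maybe Q → Bool → Energy {2 + k} → Set
    Holds l d f = ∃ λ xs → ¬ Halts (l , xs) × f (coordinate d) ≡ goedel xs × f (coordinate (not d)) ≡ 0

    -- At `scale` the loop conserves `gain * active + loss * passive`, so the configuration being
    -- processed is remembered during a partial transfer. `halted` is impossible by divergence.
    R : State Q → Energy {2 + k} → Set
    R boot         f = Holds start false f
    R halted       f = ⊥
    R (sink d)     f = 1 ≤ f (coordinate d)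
    R (choose q d) f = Holds (just q) d f
    R (doubt q d)  f = Holds (just q) d f × ∃ λ r → ∃₂ λ l₁ l₂ → instr q ≡ dec r l₁ l₂
    R (refute q d) f = base (instr q) ∣ f (coordinate d) × 1 ≤ f (coordinate d) + f (coordinate (not d))
    R (scale q d)  f = ∃ λ xs → ¬ Halts (just q , xs) ×
      gain (instr q) * f (coordinate d) + loss (instr q) * f (coordinate (not d)) ≡ gain (instr q) * goedel xs
    R (check q d)  f = R (scale q d) f

    R-goto : ∀ l d f → Holds l d f → R (goto l d) f
    R-goto nothing  d f (xs , div , _) = contradiction stop div
    R-goto (just q) d f holds          = holds

    holds-total : ∀ l d f → Holds l d f → 1 ≤ f (coordinate d) + f (coordinate (not d))
    holds-total l d f (xs , _ , a≡ , _) =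
      ≤-trans (goedelFrom≥1 0 xs) (≤-trans (≤-reflexive (sym a≡)) (m≤m+n _ _))

    holds-idle : ∀ l d {f f′} → Step f idle f′ → Holds l d f → Holds l d f′
    holds-idle l d st (xs , div , a≡ , b≡) = xs , div , trans (step-idle st (coordinate d)) a≡ , trans (step-idle st (coordinate (not d))) b≡

    scale-total : ∀ q d f → R (scale q d) f → 1 ≤ f (coordinate d) + f (coordinate (not d))
    scale-total q d f (xs , _ , eq) with f (coordinate d) | f (coordinate (not d))
    ... | suc a | b     = s≤s z≤n
    ... | zero  | suc b = s≤s z≤n
    ... | zero  | zero  = contradiction
      (≤-trans (*-mono-≤ (gain≥1 (instr q)) (goedelFrom≥1 0 xs))
               (≤-reflexive (trans (sym eq) (cong₂ _+_ (*-zeroʳ (gain (instr q))) (*-zeroʳ (loss (instr q)))))))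
      λ ()

    scale-idle : ∀ q d {f f′} → Step f idle f′ → R (scale q d) f → R (scale q d) f′
    scale-idle q d st (xs , div , eq) = xs , div
      , trans (cong₂ (λ a b → gain (instr q) * a + loss (instr q) * b) (step-idle st (coordinate d)) (step-idle st (coordinate (not d)))) eq

    -- With the active energy at 0, the conserved quantity forces the passive one to be the exact
    -- result. For `dec` it also makes the base divide the Gödel number, so a decrement of an empty
    -- register can never be completed.
    completed : ∀ (o : Operation (Maybe Q)) xs b → loss o * b ≡ gain o * goedel xs →
                ∃ λ ys → perform o xs ≡ (after o , ys) × b ≡ goedel ys
    completed (inc r l) xs b eq = increment r xs , refl , trans (sym (*-identityˡ b)) (trans eq (sym (goedel-increment r xs)))
    completed (dec r l₁ l₂) xs b eq with decrement r xs in de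
    ... | just ys = ys , refl , *-cancelˡ-≡ b (goedel ys) (sylvester r)
                                  (trans eq (trans (*-identityˡ _) (goedel-decrement r xs de)))
    ... | nothing = contradiction (divides b (trans (sym (*-identityˡ _)) (trans (sym eq) (*-comm (sylvester r) b))))
                                  (sylvester∤goedel r xs de)

    Kept : Energy {2 + k} → Vec ℤ (2 + k) × State Q → Set
    Kept = Keeps′ R

    kept-goto : ∀ l d f → Holds l d f → Kept f (idle , goto l d)
    kept-goto l d f holds f′ st = let holds′ = holds-idle l d st holds in
      R-goto l d f′ holds′ , total≥1 d f′ (holds-total l d f′ holds′)

    scale-kept : ∀ q d f → R (scale q d) f → All (Kept f) (out (scale q d))
    scale-kept q d f r@(xs , div , eq) =
        (λ f′ st → let r′ = moved f′ st in r′ , total≥1 d f′ (scale-total q d f′ r′))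
      ∷ (λ f′ st → let r′ = scale-idle q d st r in r′ , total≥1 d f′ (scale-total q d f′ r′)) ∷ []
      where
      rearrange : ∀ g l a b → g * a + l * (b + g) ≡ g * (l + a) + l * b
      rearrange = solve-∀
      moved : ∀ f′ → Step f (weight d (ℤ.- (+ loss (instr q))) (+ gain (instr q))) f′ → R (scale q d) f′
      moved f′ st = xs , div , trans
        (cong (λ b → gain (instr q) * f′ (coordinate d) + loss (instr q) * b) (sym (ℤ.+-injective (step-passive d st))))
        (trans (rearrange (gain (instr q)) (loss (instr q)) (f′ (coordinate d)) (f (coordinate (not d))))
        (trans (cong (λ a → gain (instr q) * a + loss (instr q) * f (coordinate (not d))) (sym (subtracted (loss (instr q)) (step-active d st)))) eq))

    -- P₁ decides by the active energy: a positive rest is punished in `sink`, while 0 means a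
    -- correct transfer, and the simulation continues with the roles swapped.
    check-kept : ∀ q d f → R (check q d) f → Any (Kept f) (out (check q d))
    check-kept q d f (xs , div , eq) with f (coordinate d) in a≡
    ... | suc a = here λ f′ st → let a≥1 = ≤-trans (s≤s z≤n) (≤-reflexive (sym (trans (step-idle st (coordinate d)) a≡))) in
      a≥1 , total≥1 d f′ (≤-trans a≥1 (m≤m+n _ _))
    ... | zero
      with ys , perf , b≡ ← completed (instr q) xs (f (coordinate (not d)))
             (trans (cong (_+ loss (instr q) * f (coordinate (not d))) (sym (*-zeroʳ (gain (instr q))))) eq) =
      there (here (kept-goto (after (instr q)) (not d) f
        (ys , (λ h → div (step (subst Halts (sym perf) h))) , b≡ , trans (cong (f ∘ coordinate) (not-involutive d)) a≡)))

    -- P₁ accepts a true zero claim. Otherwise the decrement succeeds and yields the divisibility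
    -- that `refute` preserves.
    doubt-kept : ∀ q d f → R (doubt q d) f → Any (Kept f) (out (doubt q d))
    doubt-kept q d f (holds@(xs , div , a≡ , b≡) , r , l₁ , l₂ , eq) with decrement r xs in de
    ... | nothing = there (here (kept-goto (otherwise (instr q)) d f (xs , div′ , a≡ , b≡)))
      where
      div′ : ¬ Halts (otherwise (instr q) , xs)
      div′ h = div (step (subst Halts (sym (trans (cong (λ o → perform o xs) eq)
                 (trans (perform-zero r xs de) (cong (λ o → otherwise o , xs) (sym eq))))) h))
    ... | just ys = here λ f′ st → let total = holds-total (just q) d f′ (holds-idle (just q) d st holds) in
      (divides (goedel ys) (trans (trans (step-idle st (coordinate d)) a≡)
        (trans (goedel-decrement r xs de) (trans (*-comm (sylvester r) (goedel ys)) (cong (λ o → goedel ys * base o) (sym eq))))) , total)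
      , total≥1 d f′ total

    refute-kept : ∀ q d f → R (refute q d) f → All (Kept f) (out (refute q d))
    refute-kept q d f (p∣a , _) = looped ∷ applyUpTo⁺₁ _ (basePred (instr q)) exited
      where
      looped : Kept f (weight d (ℤ.- (+ base (instr q))) (+ 1) , refute q d)
      looped f′ st =
        (∣m+n∣m⇒∣n (subst (base (instr q) ∣_) (subtracted (base (instr q)) (step-active d st)) p∣a) ∣-refl , total) , total≥1 d f′ total
        where
        total : 1 ≤ f′ (coordinate d) + f′ (coordinate (not d))
        total = ≤-trans (m≤n+m 1 (f (coordinate (not d))))
                  (≤-trans (≤-reflexive (ℤ.+-injective (step-passive d st))) (m≤n+m _ (f′ (coordinate d))))
      exited : ∀ {i} → i < basePred (instr q) → Kept f (weight d (ℤ.- (+ suc i)) (+ 0) , sink d)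
      exited {i} lt f′ st with f′ (coordinate d) in a′≡
      ... | suc a = s≤s z≤n , total≥1 d f′ (≤-trans (≤-trans (s≤s (z≤n {a})) (≤-reflexive (sym a′≡))) (m≤m+n _ _))
      -- Emptying the active energy here would mean that it was `suc i`, positive and below the
      -- base, yet divisible by it.
      ... | zero  = contradiction (∣⇒≤ (subst (base (instr q) ∣_) a≡ p∣a)) (<⇒≱ (s≤s lt))
        where
        a≡ : f (coordinate d) ≡ suc i
        a≡ = trans (subtracted (suc i) (trans (step-active d st) (cong +_ a′≡))) (+-identityʳ (suc i))

    choose-kept : ∀ o q d f → instr q ≡ o → R (choose q d) f → All (Kept f) (options o q d)
    choose-kept o q d f eq holds@(xs , div , a≡ , b≡) = all o eq
      where
      scaled : Kept f (idle , scale q d)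
      scaled f′ st = r′ , total≥1 d f′ (scale-total q d f′ r′)
        where
        r : R (scale q d) f
        r = xs , div , trans (cong₂ (λ a b → gain (instr q) * a + loss (instr q) * b) a≡ b≡)
                             (trans (cong (λ z → gain (instr q) * goedel xs + z) (*-zeroʳ (loss (instr q)))) (+-identityʳ _))
        r′ : R (scale q d) f′
        r′ = scale-idle q d st r
      all : ∀ o → instr q ≡ o → All (Kept f) (options o q d)
      all (inc r l)     eq = scaled ∷ []
      all (dec r l₁ l₂) eq = scaled ∷ (λ f′ st → let holds′ = holds-idle (just q) d st holds in
        (holds′ , r , l₁ , l₂ , eq) , total≥1 d f′ (holds-total (just q) d f′ holds′)) ∷ []

    sink-kept : ∀ d f → R (sink d) f → All (Kept f) (out (sink d))
    sink-kept d f a≥1 =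
        (λ f′ st → keep f′ (step-idle st (coordinate d)))
      ∷ (λ f′ st → keep f′ (trans (sym (ℤ.+-injective (step-active d st))) (+-identityʳ _))) ∷ []
      where
      keep : ∀ f′ → f′ (coordinate d) ≡ f (coordinate d) → 1 ≤ f′ (coordinate d) × 1 ≤ f′ zero + f′ (suc zero)
      keep f′ eq = let a′≥1 = ≤-trans a≥1 (≤-reflexive (sym eq)) in a′≥1 , total≥1 d f′ (≤-trans a′≥1 (m≤m+n _ _))

    closed : ∀ s f → R s f → All (Kept f) (out s) ⊎ (own s ≡ false × Any (Kept f) (out s))
    closed boot         f r = inj₁ (kept-goto start false f r ∷ [])
    closed (sink d)     f r = inj₁ (sink-kept d f r)
    closed (choose q d) f r = inj₁ (choose-kept (instr q) q d f refl r)
    closed (scale q d)  f r = inj₁ (scale-kept q d f r)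
    closed (check q d)  f r = inj₂ (refl , check-kept q d f r)
    closed (doubt q d)  f r = inj₂ (refl , doubt-kept q d f r)
    closed (refute q d) f r = inj₁ (refute-kept q d f r)

    diverges⇒¬winning : ¬ Halts (start , xs₀) → ¬ Winning game
    diverges⇒¬winning div = invariant⇒¬winning R (goedelFrom≥1 0 xs₀)
      (λ f f₀ f≡0 → xs₀ , div , f₀ , f≡0 zero) closed

-- Computing the code of a game

skip : Command
skip = raw []

add : ℕ → ℕ → Command
add r zero    = skip
add r (suc n) = inc r ； add r n

-- n is the value of the counter r and x the part of the registers that changes;
-- g n x is the value of x after the loop.
for : ∀ {X : Set} {r c} (S : ℕ → X → Registers) (f g : ℕ → X → X) →
      (∀ x → decrement r (S 0 x) ≡ nothing) → (∀ n x → decrement r (S (suc n) x) ≡ just (S n x)) →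
      (∀ n x → c ⊢ S n x ⇒ S n (f n x)) → (∀ x → g 0 x ≡ x) → (∀ n x → g n (f n x) ≡ g (suc n) x) →
      ∀ n x → while r c ⊢ S n x ⇒ S 0 (g n x)
for S f g z s body g₀ gₛ zero    x rewrite g₀ x       = while-end (z x)
for S f g z s body g₀ gₛ (suc n) x rewrite sym (gₛ n x) = while-go (s n x) (body n x) (for S f g z s body g₀ gₛ n (f n x))

-- Registers 0 to 2 hold the input, 3 the accumulator `y`, 4 the second operand `x`, 5 and 6 are
-- scratch, and 7 to 9 keep copies of the input, which the loops consume.
memory : (a b c y x s t a′ b′ c′ : ℕ) → Registers
memory a b c y x s t a′ b′ c′ = a ∷ b ∷ c ∷ y ∷ x ∷ s ∷ t ∷ a′ ∷ b′ ∷ c′ ∷ []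

move : ℕ → ℕ → Command
move r r′ = while r (inc r′)

move-loop : ∀ {r r′} (S : ℕ → ℕ → Registers) →
            (∀ x → decrement r (S 0 x) ≡ nothing) → (∀ n x → decrement r (S (suc n) x) ≡ just (S n x)) →
            (∀ n x → increment r′ (S n x) ≡ S n (suc x)) → ∀ n x → move r r′ ⊢ S n x ⇒ S 0 (n + x)
move-loop {r} {r′} S z s i = for S (λ _ → suc) _+_ z s
  (λ n x → subst (inc r′ ⊢ S n x ⇒_) (i n x) inc) (λ _ → refl) +-suc

⇒-cast : ∀ {c xs ys zs} → ys ≡ zs → c ⊢ xs ⇒ ys → c ⊢ xs ⇒ zs
⇒-cast refl e = e

module _ {a b c a′ b′ c′ : ℕ} where

  private
    M : (y x s t : ℕ) → Registers
    M y x s t = memory a b c y x s t a′ b′ c′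

  add-y : ∀ n {y x s t} → add 3 n ⊢ M y x s t ⇒ M (n + y) x s t
  add-y zero                = raw (halt refl)
  add-y (suc n) {y} {x} {s} {t} = inc ； ⇒-cast (cong (λ y → M y x s t) (+-suc n y)) (add-y n)

  add-t : ∀ n {y x s t} → add 6 n ⊢ M y x s t ⇒ M y x s (n + t)
  add-t zero                = raw (halt refl)
  add-t (suc n) {y} {x} {s} {t} = inc ； ⇒-cast (cong (M y x s) (+-suc n t)) (add-t n)

  move-t-y : ∀ t {y x s} → move 6 3 ⊢ M y x s t ⇒ M (t + y) x s 0
  move-t-y t {y} {x} {s} = move-loop (λ t y → M y x s t) (λ _ → refl) (λ _ _ → refl) (λ _ _ → refl) t y

  move-y-x : ∀ y {s t} → move 3 4 ⊢ M y 0 s t ⇒ M 0 y s t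
  move-y-x y {s} {t} = ⇒-cast (cong (λ x → M 0 x s t) (+-identityʳ y))
    (move-loop (λ y x → M y x s t) (λ _ → refl) (λ _ _ → refl) (λ _ _ → refl) y 0)

  move-x-s : ∀ x {y s t} → move 4 5 ⊢ M y x s t ⇒ M y 0 (x + s) t
  move-x-s x {y} {s} {t} = move-loop (λ x s → M y x s t) (λ _ → refl) (λ _ _ → refl) (λ _ _ → refl) x s

multiply : ℕ → Command
multiply p = while 3 (add 6 p) ； move 6 3

multiply-y : ∀ p {a b c a′ b′ c′ y x s} → multiply p ⊢ memory a b c y x s 0 a′ b′ c′ ⇒ memory a b c (p * y) x s 0 a′ b′ c′
multiply-y p {a} {b} {c} {a′} {b′} {c′} {y} {x} {s} =
    for (λ y t → memory a b c y x s t a′ b′ c′) (λ _ t → p + t) (λ n t → n * p + t) (λ _ → refl) (λ _ _ → refl)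
      (λ n t → add-t p) (λ _ → refl) (λ n t → regroup n p t) y 0
  ； ⇒-cast (cong (λ y → memory a b c y x s 0 a′ b′ c′) (tidy y p)) (move-t-y (y * p + 0))
  where
  regroup : ∀ n p t → n * p + (p + t) ≡ p + n * p + t
  regroup = solve-∀
  tidy : ∀ y p → y * p + 0 + 0 ≡ p * y
  tidy = solve-∀

-- A round that starts with `s = n + 1` adds `n + 1` to `t` and leaves `s = n`; `x` saves the
-- counter that the inner loop uses up.
addTriangle : Command
addTriangle = while 5 (inc 6 ； while 5 (inc 6 ； inc 4) ； move 4 5)

addTriangle-t : ∀ {a b c a′ b′ c′ y t} s → addTriangle ⊢ memory a b c y 0 s t a′ b′ c′ ⇒ memory a b c y 0 0 (tri s + t) a′ b′ c′
addTriangle-t {a} {b} {c} {a′} {b′} {c′} {y} {t} s =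
  for (λ s t → M 0 s t) (λ n t → n + suc t) (λ n t → tri n + t) (λ _ → refl) (λ _ _ → refl) body (λ _ → refl)
    (λ n t → regroup n (tri n) t) s t
  where
  M : (x s t : ℕ) → Registers
  M x s t = memory a b c y x s t a′ b′ c′
  regroup : ∀ n m t → m + (n + suc t) ≡ suc n + m + t
  regroup = solve-∀
  body : ∀ n t → (inc 6 ； while 5 (inc 6 ； inc 4) ； move 4 5) ⊢ M 0 n t ⇒ M 0 n (n + suc t)
  body n t = inc
    ； for (λ n (x , t) → M x n t) (λ { _ (x , t) → suc x , suc t }) (λ { n (x , t) → n + x , n + t })
         (λ _ → refl) (λ _ _ → refl) (λ _ _ → inc ； inc) (λ _ → refl) (λ { n (x , t) → cong₂ _,_ (+-suc n x) (+-suc n t) }) n (0 , suc t)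
    ； ⇒-cast (cong (λ s → M 0 s (n + suc t)) (trans (+-identityʳ (n + 0)) (+-identityʳ n))) (move-x-s (n + 0))

-- The final increment is the `suc` of `encList`, so this conses `x` onto the list coded by `y`.
pairing : Command
pairing = while 3 (inc 5 ； inc 6) ； move 4 5 ； addTriangle ； move 6 3 ； inc 3

pairing-y : ∀ {a b c a′ b′ c′ y x} → pairing ⊢ memory a b c y x 0 0 a′ b′ c′ ⇒ memory a b c (suc (pair x y)) 0 0 0 a′ b′ c′
pairing-y {a} {b} {c} {a′} {b′} {c′} {y} {x} =
    for (λ y (s , t) → M y x s t) (λ { _ (s , t) → suc s , suc t }) (λ { n (s , t) → n + s , n + t })
      (λ _ → refl) (λ _ _ → refl) (λ _ _ → inc ； inc) (λ _ → refl) (λ { n (s , t) → cong₂ _,_ (+-suc n s) (+-suc n t) }) y (0 , 0)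
  ； move-x-s x ； addTriangle-t (x + (y + 0)) ； move-t-y (tri (x + (y + 0)) + (y + 0))
  ； ⇒-cast (cong (λ y → M (suc y) 0 0 0)
       (trans (+-identityʳ _) (cong (λ z → tri (x + z) + z) (+-identityʳ y)))) inc
  where
  M : (y x s t : ℕ) → Registers
  M y x s t = memory a b c y x s t a′ b′ c′

-- Conses in the other direction: the accumulator becomes the head, the constant `n` the tail.
pairWith : ℕ → Command
pairWith n = move 3 4 ； add 3 n ； pairing

pairWith-y : ∀ n {a b c a′ b′ c′ y} → pairWith n ⊢ memory a b c y 0 0 0 a′ b′ c′ ⇒ memory a b c (suc (pair y n)) 0 0 0 a′ b′ c′
pairWith-y n {a} {b} {c} {a′} {b′} {c′} {y} = move-y-x y
  ； ⇒-cast (cong (λ n → memory a b c n y 0 0 a′ b′ c′) (+-identityʳ n)) (add-y n) ； pairing-y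

-- Moves the exponent to `r′` instead of destroying it, because the game code contains the input as
-- well as its Gödel number.
power : ℕ → ℕ → ℕ → Command
power r r′ p = while r (inc r′ ； multiply p)

power-loop : ∀ {r r′ p} (S : ℕ → ℕ × ℕ → Registers) →
  (∀ x → decrement r (S 0 x) ≡ nothing) → (∀ n x → decrement r (S (suc n) x) ≡ just (S n x)) →
  (∀ n y m → (inc r′ ； multiply p) ⊢ S n (y , m) ⇒ S n (p * y , suc m)) →
  ∀ n y → power r r′ p ⊢ S n (y , 0) ⇒ S 0 (p ^ n * y , n)
power-loop {p = p} S z s body n y = ⇒-cast (cong (λ m → S 0 (p ^ n * y , m)) (+-identityʳ n))
  (for S (λ { _ (y , m) → p * y , suc m }) (λ { n (y , m) → p ^ n * y , n + m }) z s (λ { n (y , m) → body n y m })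
    (λ { (y , m) → cong (_, m) (*-identityˡ y) })
    (λ { n (y , m) → cong₂ _,_ (regroup (p ^ n) p y) (+-suc n m) }) n (y , 0))
  where
  regroup : ∀ q p y → q * (p * y) ≡ p * q * y
  regroup = solve-∀

weightsTail thresholdCode : ℕ → ℕ
weightsTail   k = encList (Vec.toList (Vec.map encℤ (Vec.replicate (suc k) (+ 0))))
thresholdCode k = encList (Vec.toList (Vec.map encℚ (Vec.replicate (2 + k) 0ℚ)))

-- Opaque, so that conversion checking never unfolds these huge numerals.
opaque
  ownerCode : ∀ {n} → Vec Bool n → ℕ
  ownerCode bs = encList (Vec.toList (Vec.map encBool bs))

  edgesCode : ∀ {n k} → List (Edge n k) → ℕ
  edgesCode es = encList (map encEdge es)

  edgeShape : (s x w t : ℕ) → ℕ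
  edgeShape s x w t = suc (pair s (suc (pair (suc (pair x w)) (suc (pair t 0)))))

  gameShape : (n o e es i t : ℕ) → ℕ
  gameShape n o e es i t = suc (pair n (suc (pair o (suc (pair (suc (pair e es)) (suc (pair i (suc (pair t 0)))))))))

  shape-unfold : ∀ n o s x w t es i th → gameShape n o (edgeShape s x w t) es i th ≡
    suc (pair n (suc (pair o (suc (pair (suc (pair (suc (pair s (suc (pair (suc (pair x w)) (suc (pair t 0)))))) es)) (suc (pair i (suc (pair th 0)))))))))
  shape-unfold n o s x w t es i th = refl

  encEdge-shape : ∀ {n k} (s t : Fin n) x (w : Vec ℤ k) →
    encEdge (s , x ∷ w , t) ≡ edgeShape (toℕ s) (encℤ x) (encList (Vec.toList (Vec.map encℤ w))) (toℕ t)
  encEdge-shape s t x w = refl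

  encode-shape : ∀ {k} n (o : Vec Bool n) e es i (th : Vec ℚ k) →
    encode record { n = n ; owner = o ; edges = e ∷ es ; init = i ; thr = th } ≡
    gameShape n (ownerCode o) (encEdge e) (edgesCode es) (toℕ i) (encList (Vec.toList (Vec.map encℚ th)))
  encode-shape n o e es i th = refl

-- `2 * v` is the code of the integer `+ v`. The first edge leads from state 0 to state 1, the index
-- that `boot` receives.
gameCode : (k v n o es : ℕ) → ℕ
gameCode k v n o es = gameShape n o (edgeShape 0 (2 * v) (weightsTail k) 1) es 0 (thresholdCode k)

encode-gameCode : ∀ {k} (G : Instance (2 + k)) {s t v es} → let open Instance G in
  edges ≡ (s , + v ∷ Vec.replicate (suc k) (+ 0) , t) ∷ es → toℕ s ≡ 0 → toℕ t ≡ 1 → toℕ init ≡ 0 →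
  thr ≡ Vec.replicate (2 + k) 0ℚ → encode G ≡ gameCode k v n (ownerCode owner) (edgesCode es)
encode-gameCode {k} record { n = n ; owner = o ; init = i } {s} {t} {v} {es} refl s≡ t≡ i≡ refl =
  trans (encode-shape n o (s , + v ∷ Vec.replicate (suc k) (+ 0) , t) es i (Vec.replicate (2 + k) 0ℚ))
  (cong₂ (λ e i → gameShape n (ownerCode o) e (edgesCode es) i (thresholdCode k))
    (trans (encEdge-shape s t (+ v) (Vec.replicate (suc k) (+ 0)))
           (cong₂ (λ s t → edgeShape s (2 * v) (weightsTail k) t) s≡ t≡)) i≡)

gameTail : ℕ → ℕ
gameTail k = suc (pair 0 (suc (pair (thresholdCode k) 0)))

-- First the Gödel number of the input, whose other registers are 0 and contribute factors 1. Then
-- the lists are built from the inside out: weight vector, first edge, edge list, and finally the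
-- remaining fields from last to first.
computeCode : ℕ → Command
computeCode k = inc 3 ； power 2 9 (sylvester 2) ； power 1 8 (sylvester 1) ； power 0 7 (sylvester 0)
  ； multiply 2 ； pairWith (weightsTail k) ； pairWith (suc (pair 1 0)) ； pairing
  ； move 3 4 ； move 9 3 ； pairing ； pairWith (gameTail k)
  ； move 8 4 ； pairing ； move 7 4 ； pairing ； move 3 0

computeCode-correct : ∀ k a b c →
  computeCode k ⊢ memory a b c 0 0 0 0 0 0 0 ⇒
  memory (gameCode k (goedel (memory a b c 0 0 0 0 0 0 0)) a b c) 0 0 0 0 0 0 0 0 0
computeCode-correct k a b c = inc
  ； power-loop (λ { c (y , c′) → memory a b c y 0 0 0 0 0 c′ }) (λ _ → refl) (λ _ _ → refl)
       (λ n y m → inc ； multiply-y (sylvester 2)) c 1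
  ； power-loop (λ { b (y , b′) → memory a b 0 y 0 0 0 0 b′ c }) (λ _ → refl) (λ _ _ → refl)
       (λ n y m → inc ； multiply-y (sylvester 1)) b (sylvester 2 ^ c * 1)
  ； power-loop (λ { a (y , a′) → memory a 0 0 y 0 0 0 a′ b c }) (λ _ → refl) (λ _ _ → refl)
       (λ n y m → inc ； multiply-y (sylvester 0)) a (sylvester 1 ^ b * (sylvester 2 ^ c * 1))
  ； multiply-y 2 ； pairWith-y (weightsTail k) ； pairWith-y (suc (pair 1 0)) ； pairing-y
  ； move-y-x _
  ； ⇒-cast (cong (λ y → memory 0 0 0 y e 0 0 a b 0) (+-identityʳ c))
       (move-loop (λ c′ y → memory 0 0 0 y e 0 0 a b c′) (λ _ → refl) (λ _ _ → refl) (λ _ _ → refl) c 0)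
  ； pairing-y ； pairWith-y (gameTail k)
  ； ⇒-cast (cong (λ x → memory 0 0 0 g x 0 0 a 0 0) (+-identityʳ b))
       (move-loop (λ b′ x → memory 0 0 0 g x 0 0 a b′ 0) (λ _ → refl) (λ _ _ → refl) (λ _ _ → refl) b 0)
  ； pairing-y
  ； ⇒-cast (cong (λ x → memory 0 0 0 h x 0 0 0 0 0) (+-identityʳ a))
       (move-loop (λ a′ x → memory 0 0 0 h x 0 0 a′ 0 0) (λ _ → refl) (λ _ _ → refl) (λ _ _ → refl) a 0)
  ； pairing-y
  ； ⇒-cast (cong (λ x → memory x 0 0 0 0 0 0 0 0 0) (trans (+-identityʳ _) (sym (shape-unfold a b 0 (2 * goedel (memory a b c 0 0 0 0 0 0 0)) (weightsTail k) 1 c 0 (thresholdCode k)))))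
       (move-loop (λ y x → memory x 0 0 y 0 0 0 0 0 0) (λ _ → refl) (λ _ _ → refl) (λ _ _ → refl) _ 0)
  where
  e g h : ℕ
  e = suc (pair 0 (suc (pair (suc (pair (2 * goedel (memory a b c 0 0 0 0 0 0 0)) (weightsTail k))) (suc (pair 1 0)))))
  g = suc (pair (suc (pair e c)) (gameTail k))
  h = suc (pair b g)

-- Diagonalisation

run⇒exec : ∀ P x f {b} → run P x f ≡ just b → ∃₂ λ l ρ → exec P f ⟨ 0 , initRegs x ⟩ ≡ just ⟨ l , ρ ⟩ × ρ 0 ≡ b
run⇒exec P x f eq with exec P f ⟨ 0 , initRegs x ⟩ | eq
... | just ⟨ l , ρ ⟩ | refl = l , ρ , refl , refl

value-zeros : ∀ n r → value (List.replicate n 0) r ≡ 0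
value-zeros zero    r       = refl
value-zeros (suc n) zero    = refl
value-zeros (suc n) (suc r) = value-zeros n r

input-represents : ∀ n x → (x ∷ List.replicate n 0) Represents initRegs x
input-represents n x zero    = refl
input-represents n x (suc r) = value-zeros n r

loopOnOne : Program
-- Label 3 is out of range and halts; instruction 2, reached exactly from the value 1, jumps to
-- itself.
loopOnOne = dec 0 1 3 ∷ dec 0 3 2 ∷ inc 0 2 ∷ []

module Diagonal (k : ℕ) {Q : Set} (finite : Finite Q) (instr : Q → Operation (Maybe Q)) (start : Maybe Q) where
  open Machine Q instr
  open Reduction k finite instr start

  -- Read off at weight 0, but the same for every weight. They are fixed by the machine before the
  -- seed is chosen, so the self-reference is not circular.
  states owners arrows : ℕ
  states = Instance.n (Loaded.game 0)
  owners = ownerCode (Instance.owner (Loaded.game 0))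
  arrows = edgesCode laterEdges

  seed : Registers
  seed = memory states owners arrows 0 0 0 0 0 0 0

  selfGame : Instance (2 + k)
  selfGame = Loaded.game (goedel seed)

  encode-selfGame : encode selfGame ≡ gameCode k (goedel seed) states owners arrows
  encode-selfGame = encode-gameCode selfGame {es = laterEdges} refl refl refl refl refl

  computes-encode : computeCode k ⊢ seed ⇒ memory (encode selfGame) 0 0 0 0 0 0 0 0 0
  computes-encode = ⇒-cast (cong (λ x → memory x 0 0 0 0 0 0 0 0 0) (sym encode-selfGame))
    (computeCode-correct k states owners arrows)

  -- On `seed` the machine asks `P` about its own game. Answer 1 makes it diverge, so P₀ does not
  -- win, against soundness; any other answer makes it halt, so P₀ wins, against completeness.
  contradicts : ∀ P →
    (∀ {xs x f b} → computeCode k ⊢ xs ⇒ memory x 0 0 0 0 0 0 0 0 0 → run P x f ≡ just b →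
      (b ≡ 1 → ¬ Halts (start , xs)) × (b ≢ 1 → Halts (start , xs))) →
    ¬ (∀ (I : Instance (2 + k)) → WellFormed I → Decides P (encode I) (Winning I))
  contradicts P refutes decides =
    let f , b , run≡ , complete , sound = decides selfGame (Loaded.wellFormed (goedel seed))
        diverges , halts = refutes {seed} {encode selfGame} {f} {b} computes-encode run≡
        b≢1 = λ b≡1 → diverges⇒¬winning seed (diverges b≡1) (sound b≡1)
    in b≢1 (complete (halts⇒winning seed (halts b≢1)))

module _ (k : ℕ) (P : Program) where

  setup refuter : Command
  setup   = computeCode k ； raw P
  refuter = setup ； raw loopOnOne

  refuterCode : Position refuter → Operation (Maybe (Position refuter))
  refuterCode = code refuter nothing just

  refuterEntry : Maybe (Position refuter)
  refuterEntry = entry refuter nothing just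

  open Machine (Position refuter) refuterCode

  decision : ∀ {xs} → value xs 0 ≢ 1 → Halts (just (inj₂ zero) , xs)
  decision {[]}              ≢1 = step stop
  decision {zero ∷ _}        ≢1 = step stop
  decision {suc zero ∷ _}    ≢1 = contradiction refl ≢1
  decision {suc (suc _) ∷ _} ≢1 = step (step stop)

  -- The registers grow at each step, so the recursion is on the alleged halting derivation with
  -- `xs` varying.
  ¬spinning : ∀ {xs} → ¬ Halts (just (inj₂ (suc (suc zero))) , xs)
  ¬spinning (step h) = ¬spinning h

  ¬decision : ∀ {xs} → value xs 0 ≡ 1 → ¬ Halts (just (inj₂ zero) , xs)
  ¬decision {suc zero ∷ _} refl (step (step h)) = ¬spinning h

  refutes : ∀ {xs x f b} → computeCode k ⊢ xs ⇒ memory x 0 0 0 0 0 0 0 0 0 → run P x f ≡ just b →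
            (b ≡ 1 → ¬ Halts (refuterEntry , xs)) × (b ≢ 1 → Halts (refuterEntry , xs))
  refutes {x = x} {f} e run≡ =
    let l , ρ , exec≡ , ρ₀ = run⇒exec P x f run≡
        -- The computed memory is `x` followed by nine zeros, which is the initial state of `P` on
        -- input `x`.
        ys , r , rep = exec⇒Run P f 0 (initRegs x) (memory x 0 0 0 0 0 0 0 0 0) (input-represents 9 x) exec≡
        -- The exit of `setup` is the first instruction of `loopOnOne`, and the compiled refuter
        -- restricted to `inj₁` is the code of `setup` by definition.
        to , from = simulate setup {k = just (inj₂ zero)} {i = inj₁} (λ _ → refl) (e ； raw r)
        ys₀ = trans (rep 0) ρ₀
    in (λ b≡1 → ¬decision (trans ys₀ b≡1) ∘ to) , (λ b≢1 → from (decision (b≢1 ∘ trans (sym ys₀))))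

theorem5 : ∀ (k : ℕ) → 2 ≤ k →
    ¬ (Σ Program λ P → ∀ (I : Instance k) → WellFormed I → Decides P (encode I) (Winning I))
theorem5 (suc (suc k)) (s≤s (s≤s z≤n)) (P , decides) =
  Diagonal.contradicts k (Position-finite (refuter k P)) (refuterCode k P) (refuterEntry k P) P (refutes k P) decides
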